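{- Let $\mathcal{A}$ be a vector space over $\mathbb{C}$. The formula $(\underline{\psi}, g) \mapsto \underline{\psi} \cdot g$ (defined in the context) defines an action of the group $\widetilde{\mathcal{G}}$ on the set $\mathfrak{M}_{\mathcal{A}}$; that is, one has $$ (\underline{\psi} \cdot g_1) \cdot g_2 = \underline{\psi} \cdot (g_1 * g_2), \qquad \forall\, \underline{\psi} \in \mathfrak{M}_{\mathcal{A}} \text{ and } g_1, g_2 \in \widetilde{\mathcal{G}}. $$
   Context: For $n \ge 1$, $NC(n)$ is the set of non-crossing partitions of $\{1,\ldots,n\}$, partially ordered by reverse refinement: $\pi \le \sigma$ iff every block of $\sigma$ is a union of blocks of $\pi$. $1_n \in NC(n)$ is the partition with a single block. Put $NC^{(2)} := \sqcup_{n=1}^{\infty} \{ (\pi,\sigma) \mid \pi,\sigma \in NC(n),\ \pi \le \sigma \}$. For $\pi \in NC(n)$ and a non-empty $W = \{p_1 < \cdots < p_m\} \subseteq \{1,\ldots,n\}$, $\pi_W \in NC(m)$ is the partition for which $i,j$ are in the same block of $\pi_W$ iff $p_i,p_j$ are in the same block of $\pi$. $\widetilde{\mathcal{G}}$ is the set of functions $g : NC^{(2)} \to \mathbb{C}$ such that $g(\pi,\pi)=1$ for all $\pi$ and $g(\pi,\sigma) = \prod_{W \in \sigma} g(\pi_W, 1_{|W|})$ for every $n \ge 1$ and $\pi \le \sigma$ in $NC(n)$. It is a group under convolution, $(f*g)(\pi,\sigma) = \sum_{\rho:\ \pi \le \rho \le \sigma} f(\pi,\rho) g(\rho,\sigma)$.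 $\mathfrak{M}_{\mathcal{A}}$ is the set of sequences $\underline{\psi} = (\psi_n)_{n=1}^{\infty}$, where $\psi_n : \mathcal{A}^n \to \mathbb{C}$ is an $n$-linear functional. For $\underline{\psi} \in \mathfrak{M}_{\mathcal{A}}$ and $\pi \in NC(n)$, $\psi_\pi : \mathcal{A}^n \to \mathbb{C}$ is defined by $\psi_\pi(x_1,\ldots,x_n) = \prod_{V \in \pi} \psi_{|V|}((x_1,\ldots,x_n)\mid V)$, where $(x_1,\ldots,x_n)\mid V = (x_{i_1},\ldots,x_{i_k})$ for $V = \{i_1<\cdots<i_k\}$. For $\underline{\psi} \in \mathfrak{M}_{\mathcal{A}}$ and $g \in \widetilde{\mathcal{G}}$, $\underline{\psi}\cdot g := (\theta_n)_{n=1}^\infty \in \mathfrak{M}_{\mathcal{A}}$, where $\theta_n = \sum_{\pi \in NC(n)} g(\pi,1_n)\, \psi_\pi$ for all $n \ge 1$. -}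

module Defs where

open import Algebra.Bundles using (CommutativeRing)
open import Data.Nat.Base as ℕ using (ℕ; zero; suc)
open import Data.Product.Base using (∃; _×_; _,_; proj₁; proj₂)
open import Level using (0ℓ; _⊔_)
open import Relation.Binary.PropositionalEquality as ≡ using (_≡_; _≢_)
open import Relation.Binary.Structures using (IsEquivalence)

-- ℝ is the setoid of Cauchy sequences of rationals (each with a modulus of
-- convergence), two of them being equal when their difference tends to 0.

module Reals where

  import Data.Nat.Properties as ℕ
  open import Data.Rational.Base hiding (_≃_)
  open import Data.Rational.Properties hiding (≃-sym)
  open import Data.Rational.Solver using (module +-*-Solver)
  open +-*-Solver using (solve; _:=_; _:+_; _:*_; :-_)

  Cauchy : (ℕ → ℚ) → Set
  Cauchy x = ∀ ε → .{{Positive ε}} → ∃ λ N → ∀ {m n} → N ℕ.≤ m → N ℕ.≤ n → ∣ x m - x n ∣ < ε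

  record ℝ : Set where
    no-eta-equality
    field
      seq    : ℕ → ℚ
      cauchy : Cauchy seq
  open ℝ public

  infix 4 _≃_
  record _≃_ (x y : ℝ) : Set where
    constructor equal
    field
      converges : ∀ ε → .{{Positive ε}} → ∃ λ N → ∀ {n} → N ℕ.≤ n → ∣ seq x n - seq y n ∣ < ε
  open _≃_ public

  private
    module _ {I : Set} (Large : ℕ → I → Set) where

      record Null (a : I → ℚ) : Set where
        constructor mkNull
        field
          eventually< : ∀ ε → .{{Positive ε}} → ∃ λ N → ∀ {i} → Large N i → ∣ a i ∣ < ε

      record Bounded (a : I → ℚ) : Set where
        constructor mkBounded
        field
          bound       : ℚ
          bound>0     : Positive bound
          start       : ℕ
          eventually≤ : ∀ {i} → Large start i → ∣ a i ∣ ≤ bound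

    module NullProperties
      {I : Set} {Large : ℕ → I → Set}
      (antitone : ∀ {M N i} → M ℕ.≤ N → Large N i → Large M i)
      where

      null-≡ : ∀ {a b} → (∀ i → a i ≡ b i) → Null Large a → Null Large b
      null-≡ {a} {b} a≡b (mkNull null-a) = mkNull λ ε → let N , p = null-a ε in
        N , λ {i} l → ≡.subst (λ z → ∣ z ∣ < ε) (a≡b i) (p l)

      null-0 : Null Large (λ _ → 0ℚ)
      null-0 = mkNull λ ε → 0 , λ _ → positive⁻¹ ε

      null-neg : ∀ {a} → Null Large a → Null Large (λ i → - a i)
      null-neg {a} (mkNull null-a) = mkNull λ ε → let N , p = null-a ε in
        N , λ {i} l → ≡.subst (_< ε) (≡.sym (∣-p∣≡∣p∣ (a i))) (p l)

      null-+ : ∀ {a b} → Null Large a → Null Large b → Null Large (λ i → a i + b i)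
      null-+ {a} {b} (mkNull null-a) (mkNull null-b) = mkNull λ ε →
        let M , p = null-a (½ * ε) {{pos*pos⇒pos ½ ε}}
            N , q = null-b (½ * ε) {{pos*pos⇒pos ½ ε}}
        in M ℕ.⊔ N , λ {i} l → begin-strict
        ∣ a i + b i ∣      ≤⟨ ∣p+q∣≤∣p∣+∣q∣ (a i) (b i) ⟩
        ∣ a i ∣ + ∣ b i ∣  <⟨ +-mono-< (p (antitone (ℕ.m≤m⊔n M N) l)) (q (antitone (ℕ.m≤n⊔m M N) l)) ⟩
        ½ * ε + ½ * ε      ≡⟨ *-distribʳ-+ ε ½ ½ ⟨
        1ℚ * ε             ≡⟨ *-identityˡ ε ⟩
        ε                  ∎
        where open ≤-Reasoning

      null-* : ∀ {a b} → Bounded Large a → Null Large b → Null Large (λ i → a i * b i)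
      null-* {a} {b} (mkBounded B B>0 M p) (mkNull null-b) = mkNull helper
        where
        instance
          B-pos : Positive B
          B-pos = B>0
          B-nz : NonZero B
          B-nz = pos⇒nonZero B
          1/B-pos : Positive (1/ B)
          1/B-pos = 1/pos⇒pos B
        open ≤-Reasoning
        helper : ∀ ε → .{{Positive ε}} → ∃ λ N → ∀ {i} → Large N i → ∣ a i * b i ∣ < ε
        helper ε = let N , q = null-b (1/ B * ε) {{pos*pos⇒pos (1/ B) ε}} in M ℕ.⊔ N , λ {i} l → begin-strict
          ∣ a i * b i ∣      ≡⟨ ∣p*q∣≡∣p∣*∣q∣ (a i) (b i) ⟩
          ∣ a i ∣ * ∣ b i ∣  ≤⟨ *-monoʳ-≤-nonNeg ∣ b i ∣ {{∣-∣-nonNeg (b i)}} (p (antitone (ℕ.m≤m⊔n M N) l)) ⟩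
          B * ∣ b i ∣        <⟨ *-monoʳ-<-pos B (q (antitone (ℕ.m≤n⊔m M N) l)) ⟩
          B * (1/ B * ε)     ≡⟨ *-assoc B (1/ B) ε ⟨
          B * 1/ B * ε       ≡⟨ ≡.cong (_* ε) (*-inverseʳ B) ⟩
          1ℚ * ε             ≡⟨ *-identityˡ ε ⟩
          ε                  ∎

    Large₁ : ℕ → ℕ → Set
    Large₁ N n = N ℕ.≤ n

    Large₂ : ℕ → ℕ × ℕ → Set
    Large₂ N (m , n) = N ℕ.≤ m × N ℕ.≤ n

    module N₁ = NullProperties {Large = Large₁} ℕ.≤-trans
    module N₂ = NullProperties {Large = Large₂}
      (λ M≤N l → ℕ.≤-trans M≤N (proj₁ l) , ℕ.≤-trans M≤N (proj₂ l))

    toNull₂ : ∀ x → Cauchy x → Null Large₂ (λ (m , n) → x m - x n)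
    toNull₂ x c = mkNull λ ε → let N , p = c ε in N , λ l → p (proj₁ l) (proj₂ l)

    fromNull₂ : ∀ x → Null Large₂ (λ (m , n) → x m - x n) → Cauchy x
    fromNull₂ x (mkNull c) ε = let N , p = c ε in N , λ k l → p (k , l)

    bounded : ∀ x → Cauchy x → Bounded Large₁ x
    bounded x c with c 1ℚ
    ... | N , p = mkBounded (∣ x N ∣ + 1ℚ) (nonNeg+pos⇒pos ∣ x N ∣ {{∣-∣-nonNeg (x N)}} 1ℚ) N λ {n} l → begin
      ∣ x n ∣                  ≡⟨ ≡.cong ∣_∣ (solve 2 (λ a b → a := b :+ (a :+ :- b)) ≡.refl (x n) (x N)) ⟩
      ∣ x N + (x n - x N) ∣    ≤⟨ ∣p+q∣≤∣p∣+∣q∣ (x N) (x n - x N) ⟩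
      ∣ x N ∣ + ∣ x n - x N ∣  ≤⟨ +-monoʳ-≤ ∣ x N ∣ (<⇒≤ (p l ℕ.≤-refl)) ⟩
      ∣ x N ∣ + 1ℚ             ∎
      where open ≤-Reasoning

    bounded₁ : ∀ {x} → Bounded Large₁ x → Bounded Large₂ (λ (m , n) → x m)
    bounded₁ (mkBounded B B>0 N p) = mkBounded B B>0 N λ l → p (proj₁ l)

    bounded₂ : ∀ {x} → Bounded Large₁ x → Bounded Large₂ (λ (m , n) → x n)
    bounded₂ (mkBounded B B>0 N p) = mkBounded B B>0 N λ l → p (proj₂ l)

    cauchy-const : ∀ q → Cauchy (λ _ → q)
    cauchy-const q = fromNull₂ (λ _ → q) (N₂.null-≡ (λ _ → ≡.sym (+-inverseʳ q)) N₂.null-0)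

    cauchy-+ : ∀ x y → Cauchy x → Cauchy y → Cauchy (λ n → x n + y n)
    cauchy-+ x y c d = fromNull₂ (λ n → x n + y n) (N₂.null-≡
      (λ (m , n) → solve 4 (λ a b c d → (a :+ :- b) :+ (c :+ :- d) := (a :+ c) :+ :- (b :+ d))
        ≡.refl (x m) (x n) (y m) (y n))
      (N₂.null-+ (toNull₂ x c) (toNull₂ y d)))

    cauchy-neg : ∀ x → Cauchy x → Cauchy (λ n → - x n)
    cauchy-neg x c = fromNull₂ (λ n → - x n) (N₂.null-≡
      (λ (m , n) → solve 2 (λ a b → :- (a :+ :- b) := :- a :+ :- (:- b)) ≡.refl (x m) (x n))
      (N₂.null-neg (toNull₂ x c)))

    cauchy-* : ∀ x y → Cauchy x → Cauchy y → Cauchy (λ n → x n * y n)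
    cauchy-* x y c d = fromNull₂ (λ n → x n * y n) (N₂.null-≡
      (λ (m , n) → solve 4 (λ a b c d → a :* (c :+ :- d) :+ d :* (a :+ :- b) := (a :* c) :+ :- (b :* d))
        ≡.refl (x m) (x n) (y m) (y n))
      (N₂.null-+ (N₂.null-* (bounded₁ (bounded x c)) (toNull₂ y d))
                 (N₂.null-* (bounded₂ (bounded y d)) (toNull₂ x c))))

  infixl 6 _⊕_
  infixl 7 _⊗_
  infix  8 ⊖_

  fromℚ : ℚ → ℝ
  fromℚ q .seq _ = q
  fromℚ q .cauchy = cauchy-const q

  _⊕_ : ℝ → ℝ → ℝ
  (x ⊕ y) .seq n = seq x n + seq y n
  (x ⊕ y) .cauchy = cauchy-+ (seq x) (seq y) (cauchy x) (cauchy y)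

  _⊗_ : ℝ → ℝ → ℝ
  (x ⊗ y) .seq n = seq x n * seq y n
  (x ⊗ y) .cauchy = cauchy-* (seq x) (seq y) (cauchy x) (cauchy y)

  ⊖_ : ℝ → ℝ
  (⊖ x) .seq n = - seq x n
  (⊖ x) .cauchy = cauchy-neg (seq x) (cauchy x)

  private
    toNull₁ : ∀ {x y} → x ≃ y → Null Large₁ (λ n → seq x n - seq y n)
    toNull₁ (equal p) = mkNull p

    fromNull₁ : ∀ {x y} → Null Large₁ (λ n → seq x n - seq y n) → x ≃ y
    fromNull₁ (mkNull p) = equal p

    pointwise : ∀ x y → (∀ n → seq x n ≡ seq y n) → x ≃ y
    pointwise x y p = fromNull₁ (N₁.null-≡
      (λ n → ≡.trans (≡.sym (+-inverseʳ (seq y n))) (≡.cong (_- seq y n) (≡.sym (p n)))) N₁.null-0)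

    ≃-sym : ∀ {x y} → x ≃ y → y ≃ x
    ≃-sym {x} {y} p = fromNull₁ (N₁.null-≡
      (λ n → solve 2 (λ a b → :- (a :+ :- b) := b :+ :- a) ≡.refl (seq x n) (seq y n))
      (N₁.null-neg (toNull₁ p)))

    ≃-trans : ∀ {x y z} → x ≃ y → y ≃ z → x ≃ z
    ≃-trans {x} {y} {z} p q = fromNull₁ (N₁.null-≡
      (λ n → solve 3 (λ a b c → (a :+ :- b) :+ (b :+ :- c) := a :+ :- c)
        ≡.refl (seq x n) (seq y n) (seq z n))
      (N₁.null-+ (toNull₁ p) (toNull₁ q)))

    ⊕-cong : ∀ {x y u v} → x ≃ y → u ≃ v → x ⊕ u ≃ y ⊕ v
    ⊕-cong {x} {y} {u} {v} p q = fromNull₁ (N₁.null-≡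
      (λ n → solve 4 (λ a b c d → (a :+ :- b) :+ (c :+ :- d) := (a :+ c) :+ :- (b :+ d))
        ≡.refl (seq x n) (seq y n) (seq u n) (seq v n))
      (N₁.null-+ (toNull₁ p) (toNull₁ q)))

    ⊖-cong : ∀ {x y} → x ≃ y → ⊖ x ≃ ⊖ y
    ⊖-cong {x} {y} p = fromNull₁ (N₁.null-≡
      (λ n → solve 2 (λ a b → :- (a :+ :- b) := :- a :+ :- (:- b)) ≡.refl (seq x n) (seq y n))
      (N₁.null-neg (toNull₁ p)))

    ⊗-cong : ∀ {x y u v} → x ≃ y → u ≃ v → x ⊗ u ≃ y ⊗ v
    ⊗-cong {x} {y} {u} {v} p q = fromNull₁ (N₁.null-≡
      (λ n → solve 4 (λ a b c d → a :* (c :+ :- d) :+ d :* (a :+ :- b) := (a :* c) :+ :- (b :* d))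
        ≡.refl (seq x n) (seq y n) (seq u n) (seq v n))
      (N₁.null-+ (N₁.null-* (bounded (seq x) (cauchy x)) (toNull₁ q)) (N₁.null-* (bounded (seq v) (cauchy v)) (toNull₁ p))))

  private
    ⊕-assoc : ∀ x y z → (x ⊕ y) ⊕ z ≃ x ⊕ (y ⊕ z)
    ⊕-assoc x y z = pointwise _ _ (λ n → +-assoc (seq x n) (seq y n) (seq z n))

    ⊕-identityˡ : ∀ x → fromℚ 0ℚ ⊕ x ≃ x
    ⊕-identityˡ x = pointwise _ _ (λ n → +-identityˡ (seq x n))

    ⊕-identityʳ : ∀ x → x ⊕ fromℚ 0ℚ ≃ x
    ⊕-identityʳ x = pointwise _ _ (λ n → +-identityʳ (seq x n))

    ⊖-inverseˡ : ∀ x → ⊖ x ⊕ x ≃ fromℚ 0ℚ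
    ⊖-inverseˡ x = pointwise _ _ (λ n → +-inverseˡ (seq x n))

    ⊖-inverseʳ : ∀ x → x ⊕ ⊖ x ≃ fromℚ 0ℚ
    ⊖-inverseʳ x = pointwise _ _ (λ n → +-inverseʳ (seq x n))

    ⊕-comm : ∀ x y → x ⊕ y ≃ y ⊕ x
    ⊕-comm x y = pointwise _ _ (λ n → +-comm (seq x n) (seq y n))

    ⊗-assoc : ∀ x y z → (x ⊗ y) ⊗ z ≃ x ⊗ (y ⊗ z)
    ⊗-assoc x y z = pointwise _ _ (λ n → *-assoc (seq x n) (seq y n) (seq z n))

    ⊗-identityˡ : ∀ x → fromℚ 1ℚ ⊗ x ≃ x
    ⊗-identityˡ x = pointwise _ _ (λ n → *-identityˡ (seq x n))

    ⊗-identityʳ : ∀ x → x ⊗ fromℚ 1ℚ ≃ x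
    ⊗-identityʳ x = pointwise _ _ (λ n → *-identityʳ (seq x n))

    ⊗-distribˡ : ∀ x y z → x ⊗ (y ⊕ z) ≃ x ⊗ y ⊕ x ⊗ z
    ⊗-distribˡ x y z = pointwise _ _ (λ n → *-distribˡ-+ (seq x n) (seq y n) (seq z n))

    ⊗-distribʳ : ∀ x y z → (y ⊕ z) ⊗ x ≃ y ⊗ x ⊕ z ⊗ x
    ⊗-distribʳ x y z = pointwise _ _ (λ n → *-distribʳ-+ (seq x n) (seq y n) (seq z n))

    ⊗-comm : ∀ x y → x ⊗ y ≃ y ⊗ x
    ⊗-comm x y = pointwise _ _ (λ n → *-comm (seq x n) (seq y n))

    ≃-isEquivalence : IsEquivalence _≃_
    ≃-isEquivalence = record { refl = pointwise _ _ (λ _ → ≡.refl) ; sym = ≃-sym ; trans = ≃-trans }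

  ℝ-commutativeRing : CommutativeRing 0ℓ 0ℓ
  ℝ-commutativeRing = record
    { Carrier = ℝ
    ; _≈_ = _≃_
    ; _+_ = _⊕_
    ; _*_ = _⊗_
    ; -_ = ⊖_
    ; 0# = fromℚ 0ℚ
    ; 1# = fromℚ 1ℚ
    ; isCommutativeRing = record
      { isRing = record
        { +-isAbelianGroup = record
          { isGroup = record
            { isMonoid = record
              { isSemigroup = record
                { isMagma = record { isEquivalence = ≃-isEquivalence ; ∙-cong = ⊕-cong }
                ; assoc = ⊕-assoc
                }
              ; identity = ⊕-identityˡ , ⊕-identityʳ
              }
            ; inverse = ⊖-inverseˡ , ⊖-inverseʳ
            ; ⁻¹-cong = ⊖-cong
            }
          ; comm = ⊕-comm
          }
        ; *-cong = ⊗-cong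
        ; *-assoc = ⊗-assoc
        ; *-identity = ⊗-identityˡ , ⊗-identityʳ
        ; distrib = ⊗-distribˡ , ⊗-distribʳ
        }
      ; *-comm = ⊗-comm
      }
    }

module Complexification {c ℓ} (R : CommutativeRing c ℓ) where

  open CommutativeRing R
  open import Algebra.Properties.Ring ring using (-0#≈0#; -1*x≈-x)
  open import Algebra.Solver.Ring.NaturalCoefficients.Default commutativeSemiring
    using (solve; _:=_; _:+_; _:*_)

  infix 4 _≃ᶜ_
  infixl 6 _+ᶜ_
  infixl 7 _*ᶜ_

  record Complex : Set c where
    constructor _+i_
    field
      re im : Carrier
  open Complex public

  record _≃ᶜ_ (z w : Complex) : Set ℓ where
    constructor _,_
    field
      re-≈ : re z ≈ re w
      im-≈ : im z ≈ im w

  _+ᶜ_ : Complex → Complex → Complex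
  (a +i b) +ᶜ (c +i d) = (a + c) +i (b + d)

  _*ᶜ_ : Complex → Complex → Complex
  (a +i b) *ᶜ (c +i d) = (a * c - b * d) +i (a * d + b * c)

  complexRing : CommutativeRing c ℓ
  complexRing = record
    { Carrier = Complex
    ; _≈_ = _≃ᶜ_
    ; _+_ = _+ᶜ_
    ; _*_ = _*ᶜ_
    ; -_ = λ z → (- re z) +i (- im z)
    ; 0# = 0# +i 0#
    ; 1# = 1# +i 0#
    ; isCommutativeRing = record
      { isRing = record
        { +-isAbelianGroup = record
          { isGroup = record
            { isMonoid = record
              { isSemigroup = record
                { isMagma = record
                  { isEquivalence = record
                    { refl = refl , refl
                    ; sym = λ (p , q) → sym p , sym q
                    ; trans = λ (p , q) (r , s) → trans p r , trans q s
                    }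
                  ; ∙-cong = λ (p , q) (r , s) → +-cong p r , +-cong q s
                  }
                ; assoc = λ x y z → +-assoc (re x) (re y) (re z) , +-assoc (im x) (im y) (im z)
                }
              ; identity = (λ x → +-identityˡ (re x) , +-identityˡ (im x))
                         , (λ x → +-identityʳ (re x) , +-identityʳ (im x))
              }
            ; inverse = (λ x → -‿inverseˡ (re x) , -‿inverseˡ (im x))
                      , (λ x → -‿inverseʳ (re x) , -‿inverseʳ (im x))
            ; ⁻¹-cong = λ (p , q) → -‿cong p , -‿cong q
            }
          ; comm = λ x y → +-comm (re x) (re y) , +-comm (im x) (im y)
          }
        ; *-cong = λ (p , q) (r , s) →
            +-cong (*-cong p r) (-‿cong (*-cong q s)) , +-cong (*-cong p s) (*-cong q r)
        ; *-assoc = assoc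
        ; *-identity = identityˡ , λ x → ≃ᶜ-trans (comm x _) (identityˡ x)
        ; distrib = distributiveˡ
                  , λ x y z → ≃ᶜ-trans (comm (y +ᶜ z) x) (≃ᶜ-trans (distributiveˡ x y z)
                      (+-cong (_≃ᶜ_.re-≈ (comm x y)) (_≃ᶜ_.re-≈ (comm x z))
                      , +-cong (_≃ᶜ_.im-≈ (comm x y)) (_≃ᶜ_.im-≈ (comm x z))))
        }
      ; *-comm = comm
      }
    }
    where
    ≃ᶜ-trans : ∀ {x y z} → x ≃ᶜ y → y ≃ᶜ z → x ≃ᶜ z
    ≃ᶜ-trans (p , q) (r , s) = trans p r , trans q s

    -- Writing subtraction through k = -1 leaves identities between
    -- polynomials with natural coefficients.
    k : Carrier
    k = - 1#

    minus : ∀ {x y u v} → x ≈ u → y ≈ v → x - y ≈ u + k * v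
    minus {v = v} p q = +-cong p (trans (-‿cong q) (sym (-1*x≈-x v)))

    assoc : ∀ x y z → (x *ᶜ y) *ᶜ z ≃ᶜ x *ᶜ (y *ᶜ z)
    assoc (a +i b) (c +i d) (e +i f) =
      trans (minus (*-congʳ (minus refl refl)) refl)
        (trans
          (solve 7 (λ a b c d e f k →
            (a :* c :+ k :* (b :* d)) :* e :+ k :* ((a :* d :+ b :* c) :* f)
            := a :* (c :* e :+ k :* (d :* f)) :+ k :* (b :* (c :* f :+ d :* e)))
            refl a b c d e f k)
          (sym (minus (*-congˡ (minus refl refl)) refl))) ,
      trans (+-congʳ (*-congʳ (minus refl refl)))
        (trans
          (solve 7 (λ a b c d e f k →
            (a :* c :+ k :* (b :* d)) :* f :+ (a :* d :+ b :* c) :* e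
            := a :* (c :* f :+ d :* e) :+ b :* (c :* e :+ k :* (d :* f)))
            refl a b c d e f k)
          (sym (+-congˡ (*-congˡ (minus refl refl)))))

    comm : ∀ x y → x *ᶜ y ≃ᶜ y *ᶜ x
    comm (a +i b) (c +i d) =
      +-cong (*-comm a c) (-‿cong (*-comm b d)) ,
      trans (+-comm (a * d) (b * c)) (+-cong (*-comm b c) (*-comm a d))

    identityˡ : ∀ x → (1# +i 0#) *ᶜ x ≃ᶜ x
    identityˡ (a +i b) =
      trans (+-cong (*-identityˡ a) (trans (-‿cong (zeroˡ b)) -0#≈0#)) (+-identityʳ a) ,
      trans (+-cong (*-identityˡ b) (zeroˡ a)) (+-identityʳ b)

    distributiveˡ : ∀ x y z → x *ᶜ (y +ᶜ z) ≃ᶜ x *ᶜ y +ᶜ x *ᶜ z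
    distributiveˡ (a +i b) (c +i d) (e +i f) =
      trans (minus refl refl)
        (trans
          (solve 7 (λ a b c d e f k →
            a :* (c :+ e) :+ k :* (b :* (d :+ f))
            := (a :* c :+ k :* (b :* d)) :+ (a :* e :+ k :* (b :* f)))
            refl a b c d e f k)
          (sym (+-cong (minus refl refl) (minus refl refl)))) ,
      solve 6 (λ a b c d e f →
        a :* (d :+ f) :+ b :* (c :+ e)
        := (a :* d :+ b :* c) :+ (a :* f :+ b :* e)) refl a b c d e f

ℂ-commutativeRing : CommutativeRing 0ℓ 0ℓ
ℂ-commutativeRing = Complexification.complexRing Reals.ℝ-commutativeRing

open import Algebra.Module.Bundles using (Module)
open import Algebra.Module.Construct.TensorUnit using (⟨module⟩)
open import Algebra.Module.Morphism.Structures using (IsModuleHomomorphism)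
open import Data.Bool.Base using (Bool; true; false; T)
open import Data.Bool.Properties as Bool using (T?; T-≡)
open import Data.Empty using (⊥-elim)
open import Data.Fin.Base using (Fin; zero; suc; _<_)
open import Data.Fin.Induction using (<-wellFounded)
open import Data.Fin.Properties using (_≟_; _<?_; <-cmp; <-irrefl; all?; any?)
open import Data.Fin.Subset using (Subset; inside; outside; _∈_; _⊆_; ⋃; ∣_∣; Nonempty)
open import Data.Fin.Subset.Properties using (nonempty?; _⊆?_; ⊆-antisym; x∈p∪q⁻; x∈p∪q⁺; ∉⊥)
open import Data.List.Base as List using (List; []; _∷_; allFin; filter; foldr)
open import Data.List.Membership.Propositional using () renaming (_∈_ to _∈ˡ_)
open import Data.List.Membership.Propositional.Properties
  using (∈-allFin; ∈-filter⁺; ∈-filter⁻; ∈-map⁺; ∈-map⁻)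
open import Data.List.Relation.Binary.Subset.Propositional using () renaming (_⊆_ to _⊆ˡ_)
open import Data.List.Relation.Unary.All as All using (All; []; _∷_)
open import Data.List.Relation.Unary.AllPairs using ([]; _∷_)
open import Data.List.Relation.Unary.Any using (here; there)
open import Data.List.Relation.Unary.Unique.Propositional using (Unique)
import Data.List.Relation.Unary.Unique.Propositional.Properties as Unique
open import Data.Maybe.Base using (Maybe; just; nothing)
open import Data.Nat.Base using (NonZero; z<s; s<s)
open import Data.Sum.Base using (inj₁; inj₂)
open import Data.Vec.Base as Vec using (Vec; []; _∷_; lookup; tabulate; replicate)
open import Data.Vec.Functional using (Vector; updateAt)
open import Data.Vec.Functional.Properties using (updateAt-updates; updateAt-minimal)
open import Data.Vec.Properties
  using (lookup∘tabulate; lookup-replicate; lookup⇒[]=; []=⇒lookup; ≡-dec)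
open import Function.Base using (_∘_; const)
open import Function.Bundles using (_⇔_; mk⇔; Equivalence)
open import Induction.WellFounded using (Acc; acc)
open import Relation.Binary.Core using (Rel)
open import Relation.Binary.Definitions using (tri<; tri≈; tri>)
open import Relation.Nullary.Decidable
  using (Dec; yes; no; ¬?; recompute; map′; _×-dec_; _→-dec_)
open import Relation.Nullary.Negation using (¬_)

NonCrossing : ∀ {n} → Rel (Fin n) 0ℓ → Set
NonCrossing _~_ = ∀ {a b c d} → a < b → b < c → c < d → a ~ c → b ~ d → a ~ b

Matrix : ℕ → Set
Matrix n = Vec (Vec Bool n) n

Entry : ∀ {n} → Matrix n → Rel (Fin n) 0ℓ
Entry m i j = T (lookup (lookup m i) j)

-- A partition is stored as the Boolean matrix of the equivalence relation
-- "lie in the same block".  The proofs are irrelevant, so that _≡_ on NC n is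
-- equality of partitions.
record NC (n : ℕ) : Set where
  constructor mkNC
  field
    matrix         : Matrix n
    .isEquivalence : IsEquivalence (Entry matrix)
    .nonCrossing   : NonCrossing (Entry matrix)
open NC public using (matrix)

SameBlock : ∀ {n} → NC n → Rel (Fin n) 0ℓ
SameBlock π = Entry (matrix π)

module _ {n} (m : Matrix n) where

  private
    entry? : ∀ i j → Dec (Entry m i j)
    entry? i j = T? (lookup (lookup m i) j)

  isEquivalence? : Dec (IsEquivalence (Entry m))
  isEquivalence? = map′
    (λ (r , s , t) → record
      { refl = r _ ; sym = s _ _ ; trans = t _ _ _ })
    (λ e → let open IsEquivalence e in
      (λ _ → refl) , (λ _ _ → sym) , (λ _ _ _ → trans))
    (all? (λ i → entry? i i)
      ×-dec all? (λ i → all? λ j → entry? i j →-dec entry? j i)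
      ×-dec all? (λ i → all? λ j → all? λ k → entry? i j →-dec entry? j k →-dec entry? i k))

  nonCrossing? : Dec (NonCrossing (Entry m))
  nonCrossing? = map′
    (λ p {a} {b} {c} {d} → p a b c d)
    (λ p a b c d → p)
    (all? λ a → all? λ b → all? λ c → all? λ d →
      (a <? b) →-dec (b <? c) →-dec (c <? d) →-dec entry? a c →-dec entry? b d →-dec entry? a b)

  toNC : Maybe (NC n)
  toNC with isEquivalence? | nonCrossing?
  ... | yes e | yes c = just (mkNC m e c)
  ... | _     | _     = nothing

vectors : ∀ {A : Set} → List A → ∀ n → List (Vec A n)
vectors xs zero    = [] ∷ []
vectors xs (suc n) = List.cartesianProductWith _∷_ xs (vectors xs n)

allNC : ∀ n → List (NC n)
allNC n = List.mapMaybe toNC (vectors (vectors (true ∷ false ∷ []) n) n)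

sameBlock-isEquivalence : ∀ {n} (π : NC n) → IsEquivalence (SameBlock π)
sameBlock-isEquivalence (mkNC m e _) = recompute (isEquivalence? m) e

sameBlock-nonCrossing : ∀ {n} (π : NC n) → NonCrossing (SameBlock π)
sameBlock-nonCrossing (mkNC m _ c) = recompute (nonCrossing? m) c

sameBlock? : ∀ {n} (π : NC n) i j → Dec (SameBlock π i j)
sameBlock? π i j = T? (lookup (lookup (matrix π) i) j)

_≟ᴺ_ : ∀ {n} (π σ : NC n) → Dec (π ≡ σ)
mkNC m _ _ ≟ᴺ mkNC m′ _ _ = map′ (λ { ≡.refl → ≡.refl }) (≡.cong matrix)
  (≡-dec (≡-dec Bool._≟_) m m′)

private
  all-true : ∀ n → Matrix n
  all-true n = replicate n (replicate n true)

  all-true-entry : ∀ {n} i j → Entry (all-true n) i j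
  all-true-entry {n} i j rewrite lookup-replicate i (replicate n true) | lookup-replicate j true = _

𝟙 : ∀ n → NC n
𝟙 n = mkNC (all-true n)
  (record
    { refl  = λ {i} → all-true-entry i i
    ; sym   = λ {i} {j} _ → all-true-entry j i
    ; trans = λ {i} {j} {k} _ _ → all-true-entry i k })
  (λ {a} {b} _ _ _ _ _ → all-true-entry a b)

record NonemptySubset (n : ℕ) : Set where
  constructor mkNonempty
  field
    set       : Subset n
    .nonempty : Nonempty set

  size : ℕ
  size = ∣ set ∣
open NonemptySubset public using (set; size)

-- The increasing enumeration of the elements of W.
element : ∀ {n} (W : Subset n) → Fin ∣ W ∣ → Fin n
element (inside  ∷ W) zero    = zero
element (inside  ∷ W) (suc k) = suc (element W k)
element (outside ∷ W) k       = suc (element W k)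

element-mono : ∀ {n} (W : Subset n) {i j} → i < j → element W i < element W j
element-mono (inside  ∷ W) {zero}  {suc j} _         = z<s
element-mono (inside  ∷ W) {suc i} {suc j} (s<s i<j) = s<s (element-mono W i<j)
element-mono (outside ∷ W)                 i<j       = s<s (element-mono W i<j)

module _ {n} (W : Subset n) where

  element-∈ : ∀ k → element W k ∈ W
  element-∈ = go W
    where
    go : ∀ {n} (W : Subset n) k → element W k ∈ W
    go (inside  ∷ W) zero    = Vec.here
    go (inside  ∷ W) (suc k) = Vec.there (go W k)
    go (outside ∷ W) k       = Vec.there (go W k)

  element-surjective : ∀ {i} → i ∈ W → ∃ λ k → element W k ≡ i
  element-surjective = go W
    where
    go : ∀ {n} (W : Subset n) {i} → i ∈ W → ∃ λ k → element W k ≡ i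
    go (inside  ∷ W) Vec.here      = zero , ≡.refl
    go (inside  ∷ W) (Vec.there p) = let k , eq = go W p in suc k , ≡.cong suc eq
    go (outside ∷ W) (Vec.there p) = let k , eq = go W p in k , ≡.cong suc eq

  element-injective : ∀ {i j} → element W i ≡ element W j → i ≡ j
  element-injective {i} {j} eq with <-cmp i j
  ... | tri< i<j _ _ = ⊥-elim (<-irrefl eq (element-mono W i<j))
  ... | tri≈ _ i≡j _ = i≡j
  ... | tri> _ _ j<i = ⊥-elim (<-irrefl (≡.sym eq) (element-mono W j<i))

size-nonZero : ∀ {n} (W : NonemptySubset n) → NonZero (size W)
size-nonZero (mkNonempty W ne) = go W (proj₂ (recompute (nonempty? W) ne))
  where
  go : ∀ {n} {i} (W : Subset n) → i ∈ W → NonZero ∣ W ∣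
  go (inside  ∷ W) _             = _
  go (outside ∷ W) (Vec.there p) = go W p

-- restrict π W is π_W.
restrict : ∀ {n} → NC n → (W : Subset n) → NC ∣ W ∣
restrict π W = mkNC m
  (record
    { refl  = from refl
    ; sym   = from ∘ sym ∘ to
    ; trans = λ p q → from (trans (to p) (to q)) })
  (λ a<b b<c c<d p q → from
    (sameBlock-nonCrossing π (element-mono W a<b) (element-mono W b<c) (element-mono W c<d) (to p) (to q)))
  where
  open IsEquivalence (sameBlock-isEquivalence π)

  m : Matrix ∣ W ∣
  m = tabulate λ i → tabulate λ j → lookup (lookup (matrix π) (element W i)) (element W j)

  m-entry : ∀ i j → lookup (lookup m i) j ≡ lookup (lookup (matrix π) (element W i)) (element W j)
  m-entry i j = ≡.trans
    (≡.cong (λ row → lookup row j) (lookup∘tabulate _ i)) (lookup∘tabulate _ j)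

  to : ∀ {i j} → Entry m i j → SameBlock π (element W i) (element W j)
  to {i} {j} = ≡.subst T (m-entry i j)

  from : ∀ {i j} → SameBlock π (element W i) (element W j) → Entry m i j
  from {i} {j} = ≡.subst T (≡.sym (m-entry i j))

module _ {n} (π : NC n) where

  private
    open module ≈ = IsEquivalence (sameBlock-isEquivalence π) using (refl; sym; trans)

  blockSet : Fin n → Subset n
  blockSet = lookup (matrix π)

  ∈-blockSet : ∀ {i j} → j ∈ blockSet i ⇔ SameBlock π i j
  ∈-blockSet {i} {j} = mk⇔
    (λ j∈ → Equivalence.from T-≡ ([]=⇒lookup j∈))
    (λ i~j → lookup⇒[]= j (blockSet i) (Equivalence.to T-≡ i~j))

  block : Fin n → NonemptySubset n
  block i = mkNonempty (blockSet i) (i , Equivalence.from ∈-blockSet refl)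

  Least : Fin n → Set
  Least i = ∀ j → j < i → ¬ SameBlock π i j

  least? : ∀ i → Dec (Least i)
  least? i = all? λ j → (j <? i) →-dec ¬? (sameBlock? π i j)

  -- Every block is listed once, at its least element.
  leaders : List (Fin n)
  leaders = filter least? (allFin n)

  blocks : List (NonemptySubset n)
  blocks = List.map block leaders

  leader-unique : ∀ {i j} → Least i → Least j → SameBlock π i j → i ≡ j
  leader-unique {i} {j} li lj i~j with <-cmp i j
  ... | tri< i<j _ _ = ⊥-elim (lj i i<j (sym i~j))
  ... | tri≈ _ i≡j _ = i≡j
  ... | tri> _ _ j<i = ⊥-elim (li j j<i i~j)

  leader : ∀ i → ∃ λ l → l ∈ˡ leaders × SameBlock π l i
  leader i = go i (<-wellFounded i)
    where
    go : ∀ i → Acc _<_ i → ∃ λ l → l ∈ˡ leaders × SameBlock π l i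
    go i (acc rs) with any? (λ j → (j <? i) ×-dec sameBlock? π i j)
    ... | yes (j , j<i , i~j) = let l , l∈ , l~j = go j (rs j<i) in l , l∈ , trans l~j (sym i~j)
    ... | no ¬∃ = i , ∈-filter⁺ least? (∈-allFin i) (λ j j<i i~j → ¬∃ (j , j<i , i~j)) , refl

IsUnionOfBlocks : ∀ {n} → NC n → Subset n → Set
IsUnionOfBlocks {n} π U =
  ∃ λ (Vs : List (NonemptySubset n)) → Vs ⊆ˡ blocks π × ⋃ (List.map set Vs) ≡ U

infix 4 _≼_ _≼?_

record _≼_ {n} (π σ : NC n) : Set where
  constructor mk≼
  field
    unions : ∀ {W} → W ∈ˡ blocks σ → IsUnionOfBlocks π (set W)

module _ {n} {π σ : NC n} where

  private
    module π = IsEquivalence (sameBlock-isEquivalence π)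
    module σ = IsEquivalence (sameBlock-isEquivalence σ)

    ∈-⋃⁻ : ∀ (Vs : List (NonemptySubset n)) {i} → i ∈ ⋃ (List.map set Vs) → ∃ λ V → V ∈ˡ Vs × i ∈ set V
    ∈-⋃⁻ []       i∈ = ⊥-elim (∉⊥ i∈)
    ∈-⋃⁻ (V ∷ Vs) i∈ with x∈p∪q⁻ (set V) _ i∈
    ... | inj₁ i∈V = V , here ≡.refl , i∈V
    ... | inj₂ i∈⋃ = let V′ , V′∈ , i∈V′ = ∈-⋃⁻ Vs i∈⋃ in V′ , there V′∈ , i∈V′

    ∈-⋃⁺ : ∀ {Vs : List (NonemptySubset n)} {V i} → V ∈ˡ Vs → i ∈ set V → i ∈ ⋃ (List.map set Vs)
    ∈-⋃⁺ (here ≡.refl) i∈ = x∈p∪q⁺ (inj₁ i∈)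
    ∈-⋃⁺ (there V∈)    i∈ = x∈p∪q⁺ (inj₂ (∈-⋃⁺ V∈ i∈))

    to : π ≼ σ → ∀ i j → SameBlock π i j → SameBlock σ i j
    to (mk≼ unions) i j i~j =
      let l , l∈ , l~i     = leader σ i
          Vs , Vs⊆ , ⋃≡    = unions (∈-map⁺ (block σ) l∈)
          V , V∈ , i∈V     = ∈-⋃⁻ Vs (≡.subst (i ∈_) (≡.sym ⋃≡) (Equivalence.from (∈-blockSet σ) l~i))
          k , _ , V≡       = ∈-map⁻ (block π) (Vs⊆ V∈)
          k~i              = Equivalence.to (∈-blockSet π) (≡.subst (λ V → i ∈ set V) V≡ i∈V)
          j∈V              = ≡.subst (λ V → j ∈ set V) (≡.sym V≡)
                               (Equivalence.from (∈-blockSet π) (π.trans k~i i~j))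
          l~j              = Equivalence.to (∈-blockSet σ) (≡.subst (j ∈_) ⋃≡ (∈-⋃⁺ V∈ j∈V))
      in σ.trans (σ.sym l~i) l~j

    from : (∀ i j → SameBlock π i j → SameBlock σ i j) → π ≼ σ
    from coarser = mk≼ λ W∈ → let k , _ , W≡ = ∈-map⁻ (block σ) W∈ in
      ≡.subst (λ W → IsUnionOfBlocks π (set W)) (≡.sym W≡) (union k)
      where
      module _ (k : Fin n) where
        inside? : ∀ (V : NonemptySubset n) → Dec (set V ⊆ blockSet σ k)
        inside? V = set V ⊆? blockSet σ k

        Vs : List (NonemptySubset n)
        Vs = filter inside? (blocks π)

        ⋃⊆ : ⋃ (List.map set Vs) ⊆ blockSet σ k
        ⋃⊆ i∈ = let V , V∈ , i∈V = ∈-⋃⁻ Vs i∈ in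
          proj₂ (∈-filter⁻ inside? {xs = blocks π} V∈) i∈V

        ⊆⋃ : blockSet σ k ⊆ ⋃ (List.map set Vs)
        ⊆⋃ {i} i∈ =
          let l , l∈ , l~i = leader π i
              k~i          = Equivalence.to (∈-blockSet σ) i∈
          in ∈-⋃⁺
            (∈-filter⁺ inside? (∈-map⁺ (block π) l∈) (λ {j} j∈ →
              let l~j = Equivalence.to (∈-blockSet π) j∈
              in Equivalence.from (∈-blockSet σ)
                   (σ.trans k~i (coarser i j (π.trans (π.sym l~i) l~j)))))
            (Equivalence.from (∈-blockSet π) l~i)

        union : IsUnionOfBlocks π (blockSet σ k)
        union = Vs , (λ V∈ → proj₁ (∈-filter⁻ inside? {xs = blocks π} V∈)) , ⊆-antisym ⋃⊆ ⊆⋃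

  ≼⇔ : π ≼ σ ⇔ (∀ i j → SameBlock π i j → SameBlock σ i j)
  ≼⇔ = mk⇔ to from

_≼?_ : ∀ {n} (π σ : NC n) → Dec (π ≼ σ)
π ≼? σ = map′ (Equivalence.from ≼⇔) (Equivalence.to ≼⇔)
  (all? λ i → all? λ j → sameBlock? π i j →-dec sameBlock? σ i j)

≼-refl : ∀ {n} {π : NC n} → π ≼ π
≼-refl = Equivalence.from ≼⇔ λ _ _ p → p

≼-𝟙 : ∀ {n} {π : NC n} → π ≼ 𝟙 n
≼-𝟙 = Equivalence.from ≼⇔ λ i j _ → all-true-entry i j

record NC² : Set where
  constructor mkNC²
  field
    {n}         : ℕ
    .{{n≥1}}    : NonZero n
    lower upper : NC n
    .ordered    : lower ≼ upper

module Convolution {c ℓ} (K : CommutativeRing c ℓ) where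

  open CommutativeRing K

  ∑ ∏ : ∀ {a} {I : Set a} → List I → (I → Carrier) → Carrier
  ∑ xs f = foldr (λ i s → f i + s) 0# xs
  ∏ xs f = foldr (λ i p → f i * p) 1# xs

  infix 5 ∑ ∏

  syntax ∑ xs (λ i → e) = ∑[ i ← xs ] e
  syntax ∏ xs (λ i → e) = ∏[ i ← xs ] e

  ∑-cong : ∀ {a} {I : Set a} (xs : List I) {f g} → (∀ i → f i ≈ g i) → ∑ xs f ≈ ∑ xs g
  ∑-cong []       p = refl
  ∑-cong (i ∷ xs) p = +-cong (p i) (∑-cong xs p)

  ∏-cong : ∀ {a} {I : Set a} (xs : List I) {f g} → (∀ i → f i ≈ g i) → ∏ xs f ≈ ∏ xs g
  ∏-cong []       p = refl
  ∏-cong (i ∷ xs) p = *-cong (p i) (∏-cong xs p)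

  ∏-map : ∀ {a b} {I : Set a} {J : Set b} (h : I → J) xs (f : J → Carrier) →
    ∏ (List.map h xs) f ≡ ∏ xs (f ∘ h)
  ∏-map h []       f = ≡.refl
  ∏-map h (i ∷ xs) f = ≡.cong (f (h i) *_) (∏-map h xs f)

  when : ∀ {p} {P : Set p} → Dec P → (.P → Carrier) → Carrier
  when (yes p) f = f p
  when (no _)  f = 0#

  record 𝒢 : Set (c ⊔ ℓ) where
    field
      fun            : NC² → Carrier
      unital         : ∀ {n} .{{_ : NonZero n}} (π : NC n) → fun (mkNC² π π ≼-refl) ≈ 1#
      multiplicative : ∀ {n} .{{_ : NonZero n}} (π σ : NC n) .(π≼σ : π ≼ σ) →
        fun (mkNC² π σ π≼σ) ≈
        ∏[ W ← blocks σ ] fun (mkNC² {{size-nonZero W}} (restrict π (set W)) (𝟙 (size W)) ≼-𝟙)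
  open 𝒢 public

  -- Convolution, by the same formula for all functions NC² → K.
  infixl 7 _✶_

  _✶_ : (NC² → Carrier) → (NC² → Carrier) → (NC² → Carrier)
  (f ✶ g) (mkNC² {n} π σ _) = ∑[ ρ ← allNC n ]
    when (π ≼? ρ ×-dec ρ ≼? σ) λ between →
      f (mkNC² π ρ (proj₁ between)) * g (mkNC² ρ σ (proj₂ between))

  -- The identity of 𝒢.
  δ : NC² → Carrier
  δ (mkNC² π σ _) = when (π ≟ᴺ σ) λ _ → 1#

module Functionals {c ℓ m ℓm} (K : CommutativeRing c ℓ) (A : Module K m ℓm) where

  open CommutativeRing K
  open Convolution K
  open Module A using (Carrierᴹ; _≈ᴹ_; _+ᴹ_; _*ₗ_; _*ᵣ_; -ᴹ_; 0ᴹ)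
  private module A = Module A

  IsLinear : (Carrierᴹ → Carrier) → Set _
  IsLinear = IsModuleHomomorphism A.rawModule (Module.rawModule (⟨module⟩ {R = K}))

  infixl 9 _[_]≔_

  _[_]≔_ : ∀ {n} → Vector Carrierᴹ n → Fin n → Carrierᴹ → Vector Carrierᴹ n
  x [ i ]≔ a = updateAt x i (const a)

  _≋_ : ∀ {n} → Vector Carrierᴹ n → Vector Carrierᴹ n → Set ℓm
  x ≋ y = ∀ i → x i ≈ᴹ y i

  record Multilinear (n : ℕ) : Set (c ⊔ ℓ ⊔ m ⊔ ℓm) where
    field
      ⟦_⟧    : Vector Carrierᴹ n → Carrier
      cong   : ∀ {x y} → x ≋ y → ⟦ x ⟧ ≈ ⟦ y ⟧
      linear : ∀ x i → IsLinear (λ a → ⟦ x [ i ]≔ a ⟧)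
  open Multilinear public

  𝔐 : Set (c ⊔ ℓ ⊔ m ⊔ ℓm)
  𝔐 = ∀ n → .{{NonZero n}} → Multilinear n

  infix 4 _≈𝔐_

  _≈𝔐_ : 𝔐 → 𝔐 → Set (ℓ ⊔ m)
  ψ ≈𝔐 φ = ∀ n .{{_ : NonZero n}} x → ⟦ ψ n ⟧ x ≈ ⟦ φ n ⟧ x

  infixl 8 _∣_

  _∣_ : ∀ {n} → Vector Carrierᴹ n → (W : Subset n) → Vector Carrierᴹ ∣ W ∣
  (x ∣ W) k = x (element W k)

  component : 𝔐 → ∀ {n} (V : NonemptySubset n) → Multilinear (size V)
  component ψ V = ψ (size V) {{size-nonZero V}}

  -- evaluate ψ π is ψ_π.
  evaluate : 𝔐 → ∀ {n} → NC n → Vector Carrierᴹ n → Carrier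
  evaluate ψ π x = ∏[ V ← blocks π ] ⟦ component ψ V ⟧ (x ∣ set V)

  private

    isLinear : ∀ {f} →
      (∀ {a b} → a ≈ᴹ b → f a ≈ f b) →
      (∀ a b → f (a +ᴹ b) ≈ f a + f b) →
      (∀ k a → f (k *ₗ a) ≈ k * f a) →
      IsLinear f
    isLinear {f} f-cong f-+ f-* = record { isBimoduleHomomorphism = record
      { +ᴹ-isGroupHomomorphism = record
        { isMonoidHomomorphism = record
          { isMagmaHomomorphism = record
            { isRelHomomorphism = record { cong = f-cong }
            ; homo = f-+
            }
          ; ε-homo = f-0
          }
        ; ⁻¹-homo = λ a → inverseˡ-unique (f (-ᴹ a)) (f a)
            (trans (sym (f-+ (-ᴹ a) a)) (trans (f-cong (A.-ᴹ‿inverseˡ a)) f-0))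
        }
      ; *ₗ-homo = f-*
      ; *ᵣ-homo = λ k a → trans (f-cong (A.≈ᴹ-sym (A.*ₗ-*ᵣ-coincident k a))) (trans (f-* k a) (*-comm k (f a)))
      } }
      where
      open import Algebra.Properties.AbelianGroup +-abelianGroup using (inverseˡ-unique)
      f-0 : f 0ᴹ ≈ 0#
      f-0 = trans (f-cong (A.≈ᴹ-sym (A.*ₗ-zeroˡ 0ᴹ))) (trans (f-* 0# 0ᴹ) (zeroˡ (f 0ᴹ)))

    module IsLinear {f} (lin : IsLinear f) = IsModuleHomomorphism lin
      using () renaming (⟦⟧-cong to f-cong; +ᴹ-homo to f-+; *ₗ-homo to f-*)

    linear-≈ : ∀ {f g} → (∀ a → f a ≈ g a) → IsLinear f → IsLinear g
    linear-≈ {f} {g} f≈g lin = isLinear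
      (λ p → trans (sym (f≈g _)) (trans (f-cong p) (f≈g _)))
      (λ a b → trans (sym (f≈g _)) (trans (f-+ a b) (+-cong (f≈g a) (f≈g b))))
      (λ k a → trans (sym (f≈g _)) (trans (f-* k a) (*-congˡ (f≈g a))))
      where open IsLinear lin

    linear-0 : IsLinear (λ _ → 0#)
    linear-0 = isLinear (λ _ → refl) (λ _ _ → sym (+-identityˡ 0#)) (λ k _ → sym (zeroʳ k))

    linear-+ : ∀ {f g} → IsLinear f → IsLinear g → IsLinear (λ a → f a + g a)
    linear-+ lf lg = isLinear
      (λ p → +-cong (F.f-cong p) (G.f-cong p))
      (λ a b → trans (+-cong (F.f-+ a b) (G.f-+ a b)) (interchange _ _ _ _))
      (λ k a → trans (+-cong (F.f-* k a) (G.f-* k a)) (sym (distribˡ k _ _)))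
      where
      module F = IsLinear lf
      module G = IsLinear lg
      open import Algebra.Properties.CommutativeSemigroup +-commutativeSemigroup using (interchange)

    linear-* : ∀ {f} c → IsLinear f → IsLinear (λ a → c * f a)
    linear-* c lf = isLinear
      (λ p → *-congˡ (f-cong p))
      (λ a b → trans (*-congˡ (f-+ a b)) (distribˡ c _ _))
      (λ k a → trans (*-congˡ (f-* k a)) (x∙yz≈y∙xz c k _))
      where
      open IsLinear lf
      open import Algebra.Properties.CommutativeSemigroup *-commutativeSemigroup using (x∙yz≈y∙xz)

    linear-∑ : ∀ {i} {I : Set i} (xs : List I) {f : I → Carrierᴹ → Carrier} →
      (∀ i → IsLinear (f i)) → IsLinear (λ a → ∑ xs (λ i → f i a))
    linear-∑ []       lf = linear-0
    linear-∑ (i ∷ xs) lf = linear-+ (lf i) (linear-∑ xs lf)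

    linear-∏ : ∀ {i} {I : Set i} {l : I} {xs : List I} (f : I → Carrierᴹ → Carrier) →
      l ∈ˡ xs → Unique xs → IsLinear (f l) →
      (∀ {k} → k ∈ˡ xs → k ≢ l → ∀ a b → f k a ≈ f k b) →
      IsLinear (λ a → ∏ xs (λ k → f k a))
    linear-∏ {xs = l ∷ xs} f (here ≡.refl) (l≢ ∷ _) lin con =
      linear-≈ (λ a → trans (*-comm _ _) (*-congˡ (constant xs l≢ there a)))
        (linear-* (∏ xs (λ k → f k 0ᴹ)) lin)
      where
      constant : ∀ ys → All (l ≢_) ys → (∀ {k} → k ∈ˡ ys → k ∈ˡ l ∷ xs) → ∀ a →
        ∏ ys (λ k → f k 0ᴹ) ≈ ∏ ys (λ k → f k a)
      constant []       _          _  a = refl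
      constant (y ∷ ys) (l≢y ∷ l≢) ys⊆ a =
        *-cong (con (ys⊆ (here ≡.refl)) (l≢y ∘ ≡.sym) 0ᴹ a) (constant ys l≢ (ys⊆ ∘ there) a)
    linear-∏ {xs = x ∷ xs} f (there l∈) (x≢ ∷ u) lin con =
      linear-≈ (λ a → *-congʳ (con (here ≡.refl) (All.lookup x≢ l∈) 0ᴹ a))
        (linear-* (f x 0ᴹ) (linear-∏ f l∈ u lin (con ∘ there)))

    module _ {n} (x : Vector Carrierᴹ n) (i : Fin n) (W : Subset n) where

      ≔-outside : ¬ i ∈ W → ∀ a → ((x [ i ]≔ a) ∣ W) ≋ (x ∣ W)
      ≔-outside i∉W a k = A.≈ᴹ-reflexive (updateAt-minimal (element W k) i x
        (λ eq → i∉W (≡.subst (_∈ W) eq (element-∈ W k))))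

      ≔-inside : ∀ {k} → element W k ≡ i → ∀ a → ((x [ i ]≔ a) ∣ W) ≋ ((x ∣ W) [ k ]≔ a)
      ≔-inside {k} ≡.refl a j with j ≟ k
      ... | yes ≡.refl = A.≈ᴹ-reflexive (≡.trans (updateAt-updates i x) (≡.sym (updateAt-updates j (x ∣ W))))
      ... | no  j≢k    = A.≈ᴹ-reflexive (≡.trans
        (updateAt-minimal (element W j) i x (j≢k ∘ element-injective W))
        (≡.sym (updateAt-minimal j k (x ∣ W) j≢k)))

  evaluate-cong : ∀ (ψ : 𝔐) {n} (π : NC n) {x y} → x ≋ y → evaluate ψ π x ≈ evaluate ψ π y
  evaluate-cong ψ π x≋y =
    ∏-cong (blocks π) (λ V → cong (component ψ V) (λ k → x≋y (element (set V) k)))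

  evaluate-linear : ∀ (ψ : 𝔐) {n} (π : NC n) x i → IsLinear (λ a → evaluate ψ π (x [ i ]≔ a))
  evaluate-linear ψ {n} π x i =
    linear-≈ (λ a → reflexive (≡.sym (∏-map (block π) (leaders π) _)))
      (linear-∏ factor l∈ (Unique.filter⁺ (least? π) (Unique.allFin⁺ n)) linear-factor constant-factor)
    where
    open IsEquivalence (sameBlock-isEquivalence π) renaming (sym to ~-sym; trans to ~-trans) using ()

    factor : Fin n → Carrierᴹ → Carrier
    factor k a = ⟦ component ψ (block π k) ⟧ ((x [ i ]≔ a) ∣ blockSet π k)

    l : Fin n
    l = proj₁ (leader π i)

    l∈ : l ∈ˡ leaders π
    l∈ = proj₁ (proj₂ (leader π i))

    l~i : SameBlock π l i
    l~i = proj₂ (proj₂ (leader π i))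

    linear-factor : IsLinear (factor l)
    linear-factor =
      let k , k≡i = element-surjective (blockSet π l) (Equivalence.from (∈-blockSet π) l~i)
          φ       = component ψ (block π l)
      in linear-≈ (λ a → sym (cong φ (≔-inside x i (blockSet π l) k≡i a)))
           (linear φ (x ∣ blockSet π l) k)

    constant-factor : ∀ {k} → k ∈ˡ leaders π → k ≢ l → ∀ a b → factor k a ≈ factor k b
    constant-factor {k} k∈ k≢l a b = trans (unaffected a) (sym (unaffected b))
      where
      i∉ : ¬ i ∈ blockSet π k
      i∉ i∈ = k≢l (leader-unique π
        (proj₂ (∈-filter⁻ (least? π) {xs = allFin n} k∈)) (proj₂ (∈-filter⁻ (least? π) {xs = allFin n} l∈))
        (~-trans (Equivalence.to (∈-blockSet π) i∈) (~-sym l~i)))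

      unaffected : ∀ a → factor k a ≈ ⟦ component ψ (block π k) ⟧ (x ∣ blockSet π k)
      unaffected a = cong (component ψ (block π k)) (≔-outside x i (blockSet π k) i∉ a)

  -- ψ · g, by the same formula for all functions g : NC² → K.
  infixl 7 _·_

  _·_ : 𝔐 → (NC² → Carrier) → 𝔐
  ⟦ (ψ · g) n ⟧ x = ∑[ π ← allNC n ] g (mkNC² π (𝟙 n) ≼-𝟙) * evaluate ψ π x
  (ψ · g) n .cong x≋y = ∑-cong (allNC n) (λ π → *-congˡ (evaluate-cong ψ π x≋y))
  (ψ · g) n .linear x i =
    linear-∑ (allNC n) (λ π → linear-* (g (mkNC² π (𝟙 n) ≼-𝟙)) (evaluate-linear ψ π x i))

{-# OPTIONS --safe #-}

-- The point is the identity
--   (ψ · g)_ρ = ∑ { g(π, ρ) ψ_π | π ≤ ρ }   for every ρ ∈ NC(n),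
-- after which both sides of the action law are the same double sum over
-- π ≤ ρ ≤ 1.  Restricting to the blocks W of ρ identifies [0, ρ] with the
-- product of the NC(|W|), and under π ↦ (π_W) both g(π, ρ) and ψ_π are the
-- products of g(π_W, 1) and ψ_{π_W}; so the sum over π ≤ ρ is the expansion of
-- the product over W of the sums that define ψ · g.

module Submission where

open import Defs
open import Algebra.Bundles using (CommutativeMonoid; CommutativeRing)
import Algebra.Properties.CommutativeSemigroup as CommutativeSemigroupProperties
open import Algebra.Module.Bundles using (Module)
open import Data.Bool.Base using (Bool; true; false; T)
open import Data.Empty using (⊥-elim)
open import Data.Fin.Base using (Fin; zero; suc; cast; _<_)
open import Data.Fin.Properties
  using (_≟_; <-cmp; <-irrefl; <-asym; any?; cast-is-id)
open import Data.Fin.Subset using (Subset; inside; outside; _∈_; ∣_∣; ⊤)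
open import Data.Fin.Subset.Properties using (⊆-antisym; ∣⊤∣≡n)
open import Data.List.Base as List
  using (List; []; _∷_; _++_; allFin; filter; concatMap; cartesianProductWith; mapMaybe)
open import Data.List.Membership.Propositional using (find; lose) renaming (_∈_ to _∈ˡ_)
open import Data.List.Membership.Propositional.Properties
  using (∈-allFin; ∈-filter⁺; ∈-filter⁻; ∈-map⁺; ∈-map⁻; ∈-concatMap⁺; ∈-concatMap⁻;
         ∈-cartesianProductWith⁺)
open import Data.List.Membership.Propositional.Properties.WithK
  using (unique⇒irrelevant; unique∧set⇒bag)
open import Data.List.Relation.Binary.BagAndSetEquality using (∼bag⇒↭)
open import Data.List.Relation.Binary.Permutation.Propositional as ↭ using (_↭_)
open import Data.List.Relation.Unary.All as All using (All; []; _∷_)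
open import Data.List.Relation.Unary.AllPairs using ([]; _∷_)
open import Data.List.Relation.Unary.Any using (here; there)
open import Data.List.Relation.Unary.Unique.Propositional using (Unique)
import Data.List.Relation.Unary.Unique.Propositional.Properties as Unique
open import Data.Maybe.Base using (Maybe; just; nothing)
open import Data.Nat.Base using (ℕ; zero; suc; NonZero)
open import Data.Product.Base using (∃; _×_; _,_; proj₁; proj₂)
open import Data.Vec.Base as Vec using (Vec; []; _∷_; lookup; tabulate)
open import Data.Vec.Functional using (Vector)
open import Data.Vec.Properties using (lookup∘tabulate; lookup-replicate)
import Data.Vec.Properties as Vec
open import Function.Base using (_∘_)
open import Function.Bundles using (_⇔_; mk⇔; Equivalence)
open import Level using (Level; 0ℓ)
open import Relation.Binary.Core using (Rel)
open import Relation.Binary.Definitions using (tri<; tri≈; tri>)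
open import Relation.Binary.PropositionalEquality as ≡ using (_≡_)
import Relation.Binary.Reasoning.Setoid as SetoidReasoning
open import Relation.Binary.Structures using (IsEquivalence)
open import Relation.Nullary.Decidable
  using (Dec; yes; no; ⌊_⌋; toWitness; fromWitness; map′; _×-dec_)

private
  variable
    a b p : Level
    I J : Set a
    xs ys : List I
    n : ℕ

-- Finite sums and products

-- An element of a duplicate-free list has exactly one membership proof there, so equality as sets
-- is already equality as bags. All permutations used below to reindex sums and products come from
-- this.
unique-↭ : Unique xs → Unique ys → (∀ {x} → x ∈ˡ xs → x ∈ˡ ys) → (∀ {x} → x ∈ˡ ys → x ∈ˡ xs) →
  xs ↭ ys
unique-↭ u v to from = ∼bag⇒↭ (unique∧set⇒bag u v (mk⇔ to from))

unique-concatMap : (f : I → List J) → Unique xs → (∀ {x} → x ∈ˡ xs → Unique (f x)) →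
  (∀ {x y v} → x ∈ˡ xs → y ∈ˡ xs → v ∈ˡ f x → v ∈ˡ f y → x ≡ y) →
  Unique (concatMap f xs)
unique-concatMap f []        uf disj = []
unique-concatMap {xs = x ∷ xs} f (x≢ ∷ u) uf disj = Unique.++⁺ (uf (here ≡.refl))
  (unique-concatMap f u (uf ∘ there) (λ i j → disj (there i) (there j)))
  λ (v∈ , v∈′) → let y , y∈ , v∈y = find (∈-concatMap⁻ f v∈′) in
    All.lookup x≢ y∈ (disj (here ≡.refl) (there y∈) v∈ v∈y)

-- Injectivity is asked on the members of the list because `restrictions` will be shown injective on
-- the partitions below ρ, and it can identify others.
unique-map : (f : I → J) → Unique xs → (∀ {x y} → x ∈ˡ xs → y ∈ˡ xs → f x ≡ f y → x ≡ y) →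
  Unique (List.map f xs)
unique-map f []       inj = []
unique-map {xs = x ∷ xs} f (x≢ ∷ u) inj =
  All.tabulate (λ v∈ fx≡v → let y , y∈ , v≡ = ∈-map⁻ f v∈ in
    All.lookup x≢ y∈ (inj (here ≡.refl) (there y∈) (≡.trans fx≡v v≡)))
  ∷ unique-map f u (λ i j → inj (there i) (there j))

module _ (f : I → Maybe J) where

  ∈-mapMaybe⁺ : ∀ {x y} → x ∈ˡ xs → f x ≡ just y → y ∈ˡ mapMaybe f xs
  ∈-mapMaybe⁺ {xs = x ∷ xs} (here ≡.refl) eq rewrite eq = here ≡.refl
  ∈-mapMaybe⁺ {xs = x ∷ xs} (there x∈)    eq with f x
  ... | just _  = there (∈-mapMaybe⁺ x∈ eq)
  ... | nothing = ∈-mapMaybe⁺ x∈ eq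

  ∈-mapMaybe⁻ : ∀ {y} xs → y ∈ˡ mapMaybe f xs → ∃ λ x → x ∈ˡ xs × f x ≡ just y
  ∈-mapMaybe⁻ (x ∷ xs) y∈ with f x in eq | y∈
  ... | nothing | y∈′          = let x , x∈ , e = ∈-mapMaybe⁻ xs y∈′ in x , there x∈ , e
  ... | just _  | here ≡.refl  = x , here ≡.refl , eq
  ... | just _  | there y∈′    = let x , x∈ , e = ∈-mapMaybe⁻ xs y∈′ in x , there x∈ , e

  unique-mapMaybe : Unique xs → (∀ {x x′ y} → f x ≡ just y → f x′ ≡ just y → x ≡ x′) →
    Unique (mapMaybe f xs)
  unique-mapMaybe []       inj = []
  unique-mapMaybe {xs = x ∷ xs} (x≢ ∷ u) inj with f x in eq
  ... | nothing = unique-mapMaybe u inj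
  ... | just y  = All.tabulate (λ { v∈ ≡.refl → let x′ , x′∈ , eq′ = ∈-mapMaybe⁻ xs v∈ in
                    All.lookup x≢ x′∈ (inj eq eq′) })
                  ∷ unique-mapMaybe u inj

module BigOperator {c ℓ} (M : CommutativeMonoid c ℓ) where

  open CommutativeMonoid M
  open CommutativeSemigroupProperties commutativeSemigroup using (x∙yz≈y∙xz; interchange)

  -- The same fold as `∑` and `∏`, so that lemmas proved here for a commutative monoid apply to both
  -- by computation.
  ⨀ : List I → (I → Carrier) → Carrier
  ⨀ xs f = List.foldr (λ i s → f i ∙ s) ε xs

  ⨀-cong : ∀ (xs : List I) {f g} → (∀ {i} → i ∈ˡ xs → f i ≈ g i) → ⨀ xs f ≈ ⨀ xs g
  ⨀-cong []       p = refl
  ⨀-cong (i ∷ xs) p = ∙-cong (p (here ≡.refl)) (⨀-cong xs (p ∘ there))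

  ⨀-↭ : {xs ys : List I} → xs ↭ ys → ∀ f → ⨀ xs f ≈ ⨀ ys f
  ⨀-↭ ↭.refl         f = refl
  ⨀-↭ (↭.prep x p)   f = ∙-congˡ (⨀-↭ p f)
  ⨀-↭ (↭.swap x y p) f = trans (x∙yz≈y∙xz _ _ _) (∙-congˡ (∙-congˡ (⨀-↭ p f)))
  ⨀-↭ (↭.trans p q)  f = trans (⨀-↭ p f) (⨀-↭ q f)

  ⨀-++ : ∀ (xs ys : List I) f → ⨀ (xs ++ ys) f ≈ ⨀ xs f ∙ ⨀ ys f
  ⨀-++ []       ys f = sym (identityˡ _)
  ⨀-++ (x ∷ xs) ys f = trans (∙-congˡ (⨀-++ xs ys f)) (sym (assoc _ _ _))

  ⨀-map : ∀ (h : I → J) xs f → ⨀ (List.map h xs) f ≈ ⨀ xs (f ∘ h)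
  ⨀-map h []       f = refl
  ⨀-map h (x ∷ xs) f = ∙-congˡ (⨀-map h xs f)

  ⨀-concatMap : ∀ (h : I → List J) xs f → ⨀ (concatMap h xs) f ≈ ⨀ xs (λ x → ⨀ (h x) f)
  ⨀-concatMap h []       f = refl
  ⨀-concatMap h (x ∷ xs) f = trans (⨀-++ (h x) _ f) (∙-congˡ (⨀-concatMap h xs f))

  ⨀-cartesianProductWith : ∀ {k} {L : Set k} (h : I → J → L) xs ys f →
    ⨀ (cartesianProductWith h xs ys) f ≈ ⨀ xs (λ x → ⨀ ys (λ y → f (h x y)))
  ⨀-cartesianProductWith h []       ys f = refl
  ⨀-cartesianProductWith h (x ∷ xs) ys f = trans (⨀-++ (List.map (h x) ys) _ f)
    (∙-cong (⨀-map (h x) ys f) (⨀-cartesianProductWith h xs ys f))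

  ⨀-∙ : ∀ (xs : List I) f g → ⨀ xs (λ x → f x ∙ g x) ≈ ⨀ xs f ∙ ⨀ xs g
  ⨀-∙ []       f g = sym (identityˡ ε)
  ⨀-∙ (x ∷ xs) f g = trans (∙-congˡ (⨀-∙ xs f g)) (interchange _ _ _ _)

  ⨀-ε : ∀ (xs : List I) → ⨀ xs (λ _ → ε) ≈ ε
  ⨀-ε []       = refl
  ⨀-ε (x ∷ xs) = trans (identityˡ _) (⨀-ε xs)

  ⨀-swap : ∀ (xs : List I) (ys : List J) (f : I → J → Carrier) →
    ⨀ xs (λ x → ⨀ ys (f x)) ≈ ⨀ ys (λ y → ⨀ xs (λ x → f x y))
  ⨀-swap []       ys f = sym (⨀-ε ys)
  ⨀-swap (x ∷ xs) ys f = trans (∙-congˡ (⨀-swap xs ys f)) (sym (⨀-∙ ys (f x) _))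

module _ {P : I → Set p} where

  -- The cartesian product of the lists `ps i`. Its tuples are stored as `All` because their
  -- components have different types: a partition of a block W lives in NC(|W|).
  choices : (∀ i → List (P i)) → ∀ is → List (All P is)
  choices ps []       = [] ∷ []
  choices ps (i ∷ is) = cartesianProductWith _∷_ (ps i) (choices ps is)

  ∈-choices : ∀ {ps : ∀ i → List (P i)} → (∀ {i} q → q ∈ˡ ps i) → ∀ {is} (qs : All P is) →
    qs ∈ˡ choices ps is
  ∈-choices ∈ps []       = here ≡.refl
  ∈-choices ∈ps (q ∷ qs) = ∈-cartesianProductWith⁺ _∷_ (∈ps q) (∈-choices ∈ps qs)

  unique-choices : ∀ {ps : ∀ i → List (P i)} → (∀ i → Unique (ps i)) → ∀ is → Unique (choices ps is)
  unique-choices u []       = [] ∷ []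
  unique-choices u (i ∷ is) = Unique.cartesianProductWith⁺ _∷_ (λ { ≡.refl → ≡.refl , ≡.refl })
    (u i) (unique-choices u is)

  choice-≡ : ∀ {is} {ps qs : All P is} → (∀ {i} (i∈ : i ∈ˡ is) → All.lookup ps i∈ ≡ All.lookup qs i∈) →
    ps ≡ qs
  choice-≡ {ps = []}     {[]}     eq = ≡.refl
  choice-≡ {ps = p ∷ ps} {q ∷ qs} eq = ≡.cong₂ _∷_ (eq (here ≡.refl)) (choice-≡ (eq ∘ there))

  lookup-universal : ∀ (f : ∀ i → P i) {is i} (i∈ : i ∈ˡ is) → All.lookup (All.universal f is) i∈ ≡ f i
  lookup-universal f (here ≡.refl) = ≡.refl
  lookup-universal f (there i∈)    = lookup-universal f i∈

module SumsAndProducts {c ℓ} (K : CommutativeRing c ℓ) where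

  open CommutativeRing K
  open Convolution K
  module Sum = BigOperator +-commutativeMonoid
  module Prod = BigOperator *-commutativeMonoid
  open SetoidReasoning setoid

  ∑-*ˡ : ∀ k (xs : List I) f → k * ∑ xs f ≈ ∑ xs (λ x → k * f x)
  ∑-*ˡ k []       f = zeroʳ k
  ∑-*ˡ k (x ∷ xs) f = trans (distribˡ k _ _) (+-congˡ (∑-*ˡ k xs f))

  ∑-*ʳ : ∀ k (xs : List I) f → ∑ xs f * k ≈ ∑ xs (λ x → f x * k)
  ∑-*ʳ k []       f = zeroˡ k
  ∑-*ʳ k (x ∷ xs) f = trans (distribʳ k _ _) (+-congˡ (∑-*ʳ k xs f))

  when-cong : ∀ {p q} {P : Set p} {Q : Set q} (P? : Dec P) (Q? : Dec Q)
    {f : .P → Carrier} {g : .Q → Carrier} →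
    (P → Q) → (Q → P) → (∀ p q → f p ≈ g q) → when P? f ≈ when Q? g
  when-cong (yes p) (yes q) to from f≈g = f≈g p q
  when-cong (yes p) (no ¬q) to from f≈g = ⊥-elim (¬q (to p))
  when-cong (no ¬p) (yes q) to from f≈g = ⊥-elim (¬p (from q))
  when-cong (no _)  (no _)  to from f≈g = refl

  when-*ˡ : ∀ {p} {P : Set p} k (P? : Dec P) {f : .P → Carrier} → k * when P? f ≈ when P? (λ p → k * f p)
  when-*ˡ k (yes p) = refl
  when-*ˡ k (no _)  = zeroʳ k

  when-*ʳ : ∀ {p} {P : Set p} k (P? : Dec P) {f : .P → Carrier} → when P? f * k ≈ when P? (λ p → f p * k)
  when-*ʳ k (yes p) = refl
  when-*ʳ k (no _)  = zeroˡ k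

  ∑-filter : ∀ {P : I → Set p} (P? : ∀ i → Dec (P i)) xs f →
    ∑ (filter P? xs) f ≈ ∑ xs (λ x → when (P? x) (λ _ → f x))
  ∑-filter P? []       f = refl
  ∑-filter P? (x ∷ xs) f with P? x
  ... | yes _ = +-congˡ (∑-filter P? xs f)
  ... | no _  = trans (∑-filter P? xs f) (sym (+-identityˡ _))

  module _ {P : I → Set p} (F : ∀ i → P i → Carrier) where

    choiceProduct : ∀ {is} → All P is → Carrier
    choiceProduct []                 = 1#
    choiceProduct (_∷_ {x = i} q qs) = F i q * choiceProduct qs

    choiceProduct-universal : ∀ f is → choiceProduct (All.universal f is) ≡ ∏ is (λ i → F i (f i))
    choiceProduct-universal f []       = ≡.refl
    choiceProduct-universal f (i ∷ is) = ≡.cong (F i (f i) *_) (choiceProduct-universal f is)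

    -- Iterated distributivity. It will turn a product over blocks of the sums defining ψ · g into
    -- one sum over tuples of partitions of the blocks.
    ∏-∑ : ∀ (ps : ∀ i → List (P i)) is → ∏ is (λ i → ∑ (ps i) (F i)) ≈ ∑ (choices ps is) choiceProduct
    ∏-∑ ps []       = sym (+-identityʳ 1#)
    ∏-∑ ps (i ∷ is) = begin
      ∑ (ps i) (F i) * ∏ is (λ i → ∑ (ps i) (F i))
        ≈⟨ *-congˡ (∏-∑ ps is) ⟩
      ∑ (ps i) (F i) * ∑ (choices ps is) choiceProduct
        ≈⟨ ∑-*ʳ _ (ps i) (F i) ⟩
      ∑ (ps i) (λ q → F i q * ∑ (choices ps is) choiceProduct)
        ≈⟨ ∑-cong (ps i) (λ q → ∑-*ˡ (F i q) (choices ps is) choiceProduct) ⟩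
      ∑ (ps i) (λ q → ∑ (choices ps is) (λ qs → F i q * choiceProduct qs))
        ≈⟨ Sum.⨀-cartesianProductWith _∷_ (ps i) (choices ps is) choiceProduct ⟨
      ∑ (choices ps (i ∷ is)) choiceProduct ∎

-- Enumeration of the non-crossing partitions

∈-vectors : ∀ {A : Set} {as : List A} → (∀ a → a ∈ˡ as) → (v : Vec A n) → v ∈ˡ vectors as n
∈-vectors ∈as []      = here ≡.refl
∈-vectors ∈as (a ∷ v) = ∈-cartesianProductWith⁺ _∷_ (∈as a) (∈-vectors ∈as v)

unique-vectors : ∀ {A : Set} {as : List A} → Unique as → ∀ n → Unique (vectors as n)
unique-vectors u zero    = [] ∷ []
unique-vectors u (suc n) = Unique.cartesianProductWith⁺ _∷_ (λ { ≡.refl → ≡.refl , ≡.refl })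
  u (unique-vectors u n)

-- The proofs found by the decision procedures may differ from those stored in π, but irrelevance
-- makes the two records definitionally equal.
toNC-matrix : (π : NC n) → toNC (matrix π) ≡ just π
toNC-matrix π@(mkNC m _ _) with isEquivalence? m | nonCrossing? m
... | yes _ | yes _ = ≡.refl
... | no ¬e | _     = ⊥-elim (¬e (sameBlock-isEquivalence π))
... | yes _ | no ¬c = ⊥-elim (¬c (sameBlock-nonCrossing π))

matrix-toNC : (m : Matrix n) {π : NC n} → toNC m ≡ just π → matrix π ≡ m
matrix-toNC m eq with isEquivalence? m | nonCrossing? m | eq
... | yes _ | yes _ | ≡.refl = ≡.refl

∈-allNC : (π : NC n) → π ∈ˡ allNC n
∈-allNC π = ∈-mapMaybe⁺ toNC
  (∈-vectors (∈-vectors λ { true → here ≡.refl ; false → there (here ≡.refl) }) (matrix π))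
  (toNC-matrix π)

unique-allNC : ∀ n → Unique (allNC n)
unique-allNC n = unique-mapMaybe toNC
  (unique-vectors (unique-vectors (((λ ()) ∷ []) ∷ [] ∷ []) n) n)
  (λ {m} {m′} eq eq′ → ≡.trans (≡.sym (matrix-toNC m eq)) (matrix-toNC m′ eq′))

-- Partitions determined by their relation

vec-≡ : ∀ {A : Set a} {u v : Vec A n} → (∀ i → lookup u i ≡ lookup v i) → u ≡ v
vec-≡ {u = u} {v} eq =
  ≡.trans (≡.sym (Vec.tabulate∘lookup u)) (≡.trans (Vec.tabulate-cong eq) (Vec.tabulate∘lookup v))

T-injective : ∀ {x y} → T x ⇔ T y → x ≡ y
T-injective {false} {false} eq = ≡.refl
T-injective {false} {true}  eq = ⊥-elim (Equivalence.from eq _)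
T-injective {true}  {false} eq = ⊥-elim (Equivalence.to eq _)
T-injective {true}  {true}  eq = ≡.refl

-- A Boolean entry is determined by its truth, and the remaining fields of `NC` are irrelevant.
NC-≡ : {π σ : NC n} → (∀ i j → SameBlock π i j ⇔ SameBlock σ i j) → π ≡ σ
NC-≡ {π = mkNC m _ _} {mkNC m′ _ _} eq with vec-≡ {u = m} {m′} (λ i → vec-≡ (λ j → T-injective (eq i j)))
... | ≡.refl = ≡.refl

tabulate-entry : ∀ {m} (f : Fin m → Fin n → Bool) i j →
  lookup (lookup (tabulate (λ i → tabulate (f i))) i) j ≡ f i j
tabulate-entry f i j =
  ≡.trans (≡.cong (λ row → lookup row j) (lookup∘tabulate _ i)) (lookup∘tabulate (f i) j)

module _ {R : Rel (Fin n) 0ℓ} (R? : ∀ i j → Dec (R i j)) where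

  relationMatrix : Matrix n
  relationMatrix = tabulate λ i → tabulate λ j → ⌊ R? i j ⌋

  entry⇔ : ∀ {i j} → Entry relationMatrix i j ⇔ R i j
  entry⇔ {i} {j} = mk⇔
    (λ e → toWitness (≡.subst T (tabulate-entry _ i j) e))
    (λ r → ≡.subst T (≡.sym (tabulate-entry _ i j)) (fromWitness r))

  fromRelation : IsEquivalence R → NonCrossing R → NC n
  fromRelation e nc = mkNC relationMatrix
    (record
      { refl  = from refl
      ; sym   = from ∘ sym ∘ to
      ; trans = λ p q → from (trans (to p) (to q)) })
    (λ a<b b<c c<d p q → from (nc a<b b<c c<d (to p) (to q)))
    where
    open IsEquivalence e
    to : ∀ {i j} → Entry relationMatrix i j → R i j
    to = Equivalence.to entry⇔
    from : ∀ {i j} → R i j → Entry relationMatrix i j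
    from = Equivalence.from entry⇔

sameBlock-restrict : (π : NC n) (W : Subset n) {i j : Fin ∣ W ∣} →
  SameBlock (restrict π W) i j ⇔ SameBlock π (element W i) (element W j)
sameBlock-restrict π W {i} {j} = mk⇔
  (≡.subst T (tabulate-entry _ i j)) (≡.subst T (≡.sym (tabulate-entry _ i j)))

leaders-least : (π : NC n) {l : Fin n} → l ∈ˡ leaders π → Least π l
leaders-least {n} π l∈ = proj₂ (∈-filter⁻ (least? π) {xs = allFin n} l∈)

unique-leaders : (π : NC n) → Unique (leaders π)
unique-leaders {n} π = Unique.filter⁺ (least? π) (Unique.allFin⁺ n)

leaders-≡ : (π : NC n) {l l′ : Fin n} → l ∈ˡ leaders π → l′ ∈ˡ leaders π → SameBlock π l l′ → l ≡ l′
leaders-≡ π l∈ l′∈ = leader-unique π (leaders-least π l∈) (leaders-least π l′∈)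

-- Restriction to a subset closed under a partition

element-cancel-< : (W : Subset n) {i j : Fin ∣ W ∣} → element W i < element W j → i < j
element-cancel-< W {i} {j} lt with <-cmp i j
... | tri< i<j _ _    = i<j
... | tri≈ _ ≡.refl _ = ⊥-elim (<-irrefl ≡.refl lt)
... | tri> _ _ j<i    = ⊥-elim (<-asym lt (element-mono W j<i))

-- The image of V under `element W`. The recursion follows that of `element`, so that sizes and
-- enumerations can be compared by the same induction.
embed : (W : Subset n) → Subset ∣ W ∣ → Subset n
embed []            []      = []
embed (inside  ∷ W) (v ∷ V) = v ∷ embed W V
embed (outside ∷ W) V       = outside ∷ embed W V

∈-embed⁺ : (W : Subset n) {V : Subset ∣ W ∣} {k : Fin ∣ W ∣} → k ∈ V → element W k ∈ embed W V
∈-embed⁺ (inside  ∷ W) Vec.here       = Vec.here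
∈-embed⁺ (inside  ∷ W) (Vec.there k∈) = Vec.there (∈-embed⁺ W k∈)
∈-embed⁺ (outside ∷ W) k∈             = Vec.there (∈-embed⁺ W k∈)

∈-embed⁻ : (W : Subset n) {V : Subset ∣ W ∣} {j : Fin n} → j ∈ embed W V →
  ∃ λ k → k ∈ V × element W k ≡ j
∈-embed⁻ []            {[]}    ()
∈-embed⁻ (inside  ∷ W) {v ∷ V} Vec.here       = zero , Vec.here , ≡.refl
∈-embed⁻ (inside  ∷ W) {v ∷ V} (Vec.there j∈) =
  let k , k∈ , eq = ∈-embed⁻ W j∈ in suc k , Vec.there k∈ , ≡.cong suc eq
∈-embed⁻ (outside ∷ W) {V}     (Vec.there j∈) =
  let k , k∈ , eq = ∈-embed⁻ W j∈ in k , k∈ , ≡.cong suc eq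

∣embed∣ : (W : Subset n) (V : Subset ∣ W ∣) → ∣ embed W V ∣ ≡ ∣ V ∣
∣embed∣ []            []            = ≡.refl
∣embed∣ (inside  ∷ W) (inside  ∷ V) = ≡.cong suc (∣embed∣ W V)
∣embed∣ (inside  ∷ W) (outside ∷ V) = ∣embed∣ W V
∣embed∣ (outside ∷ W) V             = ∣embed∣ W V

-- Both sides list the image of V in increasing order. The two index types agree only up to a
-- provable equality of sizes, hence the `cast`.
element-embed : (W : Subset n) (V : Subset ∣ W ∣) .(eq : ∣ embed W V ∣ ≡ ∣ V ∣) → ∀ k →
  element (embed W V) k ≡ element W (element V (cast eq k))
element-embed []            []            eq ()
element-embed (inside  ∷ W) (inside  ∷ V) eq zero    = ≡.refl
element-embed (inside  ∷ W) (inside  ∷ V) eq (suc k) = ≡.cong suc (element-embed W V _ k)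
element-embed (inside  ∷ W) (outside ∷ V) eq k       = ≡.cong suc (element-embed W V eq k)
element-embed (outside ∷ W) V             eq k       = ≡.cong suc (element-embed W V eq k)

element-⊤ : ∀ n .(eq : ∣ ⊤ {n} ∣ ≡ n) k → element ⊤ k ≡ cast eq k
element-⊤ (suc n) eq zero    = ≡.refl
element-⊤ (suc n) eq (suc k) = ≡.cong suc (element-⊤ n _ k)

-- In other words, W is a union of blocks of π. The blocks of the restriction to W then correspond
-- to the blocks of π inside W.
Closed : NC n → Subset n → Set
Closed π W = ∀ {i j} → SameBlock π i j → i ∈ W → j ∈ W

module _ (π : NC n) {W : Subset n} (closed : Closed π W) where

  -- By closedness the whole block of `element W k` lies in W, so each of its members has the form
  -- `element W k′` and is seen by the restriction.
  blockSet-element : ∀ k → blockSet π (element W k) ≡ embed W (blockSet (restrict π W) k)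
  blockSet-element k = ⊆-antisym
    (λ j∈ →
      let k~j = Equivalence.to (∈-blockSet π) j∈
          k′ , eq = element-surjective W (closed k~j (element-∈ W k))
      in ≡.subst (_∈ _) eq (∈-embed⁺ W (Equivalence.from (∈-blockSet (restrict π W))
           (Equivalence.from (sameBlock-restrict π W)
             (≡.subst (SameBlock π (element W k)) (≡.sym eq) k~j)))))
    (λ j∈ →
      let k′ , k′∈ , eq = ∈-embed⁻ W j∈
      in Equivalence.from (∈-blockSet π) (≡.subst (SameBlock π (element W k)) eq
           (Equivalence.to (sameBlock-restrict π W)
             (Equivalence.to (∈-blockSet (restrict π W)) k′∈))))

  -- `element W` preserves and reflects the order, and any smaller element of the same block of π
  -- again lies in W; so being least means the same in W and in the full set.
  leaders-element : ∀ {k} → k ∈ˡ leaders (restrict π W) ⇔ element W k ∈ˡ leaders π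
  leaders-element {k} = mk⇔
    (λ k∈ → ∈-filter⁺ (least? π) (∈-allFin _) λ j j<k k~j →
      let k′ , eq = element-surjective W (closed k~j (element-∈ W k))
      in leaders-least (restrict π W) k∈ k′
           (element-cancel-< W (≡.subst (_< element W k) (≡.sym eq) j<k))
           (Equivalence.from (sameBlock-restrict π W)
             (≡.subst (SameBlock π (element W k)) (≡.sym eq) k~j)))
    (λ l∈ → ∈-filter⁺ (least? (restrict π W)) (∈-allFin _) λ k′ k′<k k~k′ →
      leaders-least π l∈ (element W k′) (element-mono W k′<k)
        (Equivalence.to (sameBlock-restrict π W) k~k′))

-- The interval [0, ρ] as a product over the blocks of ρ

module _ (ρ : NC n) where

  open IsEquivalence (sameBlock-isEquivalence ρ) using () renaming (sym to ρ-sym; trans to ρ-trans)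

  element-∈-block : ∀ {l} k → SameBlock ρ l (element (blockSet ρ l) k)
  element-∈-block {l} k = Equivalence.to (∈-blockSet ρ) (element-∈ (blockSet ρ l) k)

  block-element : ∀ {l i} → SameBlock ρ l i → ∃ λ k → element (blockSet ρ l) k ≡ i
  block-element {l} l~i = element-surjective (blockSet ρ l) (Equivalence.from (∈-blockSet ρ) l~i)

  blockSet-closed : ∀ {π} → π ≼ ρ → ∀ l → Closed π (blockSet ρ l)
  blockSet-closed π≼ρ l i~j i∈ = Equivalence.from (∈-blockSet ρ)
    (ρ-trans (Equivalence.to (∈-blockSet ρ) i∈) (Equivalence.to ≼⇔ π≼ρ _ _ i~j))

  -- Each block of π lies in exactly one block of ρ, so its least element comes from exactly one
  -- leader of exactly one restriction.
  leaders-restrict : ∀ {π} → π ≼ ρ →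
    leaders π ↭
    concatMap (λ l → List.map (element (blockSet ρ l)) (leaders (restrict π (blockSet ρ l)))) (leaders ρ)
  leaders-restrict {π} π≼ρ = unique-↭ (unique-leaders π)
    (unique-concatMap images (unique-leaders ρ)
      (λ {l} _ → Unique.map⁺ (element-injective (blockSet ρ l))
        (unique-leaders (restrict π (blockSet ρ l))))
      -- An element listed under both l and l′ lies in both of their blocks of ρ, so the two leaders
      -- coincide.
      (λ {l} {l′} l∈ l′∈ v∈ v∈′ →
        let k  , _ , eq  = ∈-map⁻ (element (blockSet ρ l)) v∈
            k′ , _ , eq′ = ∈-map⁻ (element (blockSet ρ l′)) v∈′
        in leaders-≡ ρ l∈ l′∈ (ρ-trans
             (≡.subst (SameBlock ρ l) (≡.trans (≡.sym eq) eq′) (element-∈-block k))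
             (ρ-sym (element-∈-block k′)))))
    (λ {i} i∈ →
      let l , l∈ , l~i = leader ρ i
          k , eq       = block-element l~i
          closed       = blockSet-closed π≼ρ l
      in ∈-concatMap⁺ images (lose l∈ (≡.subst (_∈ˡ images l) eq
           (∈-map⁺ (element (blockSet ρ l))
             (Equivalence.from (leaders-element π closed) (≡.subst (_∈ˡ leaders π) (≡.sym eq) i∈))))))
    (λ i∈ →
      let l , l∈ , i∈l = find (∈-concatMap⁻ images {xs = leaders ρ} i∈)
          k , k∈ , eq  = ∈-map⁻ (element (blockSet ρ l)) i∈l
      in ≡.subst (_∈ˡ leaders π) (≡.sym eq)
           (Equivalence.to (leaders-element π (blockSet-closed π≼ρ l)) k∈))
    where
    images : Fin n → List (Fin n)
    images l = List.map (element (blockSet ρ l)) (leaders (restrict π (blockSet ρ l)))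

  BlockPartition : Fin n → Set
  BlockPartition l = NC (size (block ρ l))

  restrictions : NC n → All BlockPartition (leaders ρ)
  restrictions π = All.universal (λ l → restrict π (blockSet ρ l)) (leaders ρ)

  -- Two elements related by a partition below ρ share a block of ρ, and whether they are related
  -- can be read off the restriction to that block.
  restrictions-injective : ∀ {π σ} → π ≼ ρ → σ ≼ ρ → restrictions π ≡ restrictions σ → π ≡ σ
  restrictions-injective {π} {σ} π≼ρ σ≼ρ eq =
    NC-≡ (λ i j → mk⇔ (transfer {π} {σ} π≼ρ eq i j) (transfer {σ} {π} σ≼ρ (≡.sym eq) i j))
    where
    transfer : ∀ {π σ} → π ≼ ρ → restrictions π ≡ restrictions σ → ∀ i j →
      SameBlock π i j → SameBlock σ i j
    transfer {π} {σ} π≼ρ eq i j i~j =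
      let l , l∈ , l~i = leader ρ i
          W            = blockSet ρ l
          k  , k≡i     = block-element l~i
          k′ , k′≡j    = block-element (ρ-trans l~i (Equivalence.to ≼⇔ π≼ρ i j i~j))
          πW≡σW : restrict π W ≡ restrict σ W
          πW≡σW        = ≡.trans (≡.sym (lookup-universal (λ l → restrict π (blockSet ρ l)) l∈))
                          (≡.trans (≡.cong (λ τs → All.lookup τs l∈) eq)
                            (lookup-universal (λ l → restrict σ (blockSet ρ l)) l∈))
      in ≡.subst₂ (SameBlock σ) k≡i k′≡j (Equivalence.to (sameBlock-restrict σ W)
           (≡.subst (λ τ → SameBlock τ k k′) πW≡σW (Equivalence.from (sameBlock-restrict π W)
             (≡.subst₂ (SameBlock π) (≡.sym k≡i) (≡.sym k′≡j) i~j))))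

  -- Construction of a preimage under `restrictions`: partitions of the blocks of ρ are assembled
  -- into a partition of the whole set. The family τ is indexed by membership proofs so that it can
  -- be the lookup function of a tuple.
  module Glue (τ : ∀ {l} → l ∈ˡ leaders ρ → BlockPartition l) where

    data Glued (i j : Fin n) : Set where
      glued : ∀ {l} (l∈ : l ∈ˡ leaders ρ) {k k′} →
        element (blockSet ρ l) k ≡ i → element (blockSet ρ l) k′ ≡ j → SameBlock (τ l∈) k k′ → Glued i j

    -- The leader and the index k witnessing i can be prescribed. Both leaders have i in their block
    -- and so coincide; their membership proofs coincide since `leaders ρ` has no duplicates; and
    -- `element` is injective. This gives transitivity, and it lets `glued?` search a single block.
    glued⁻ : ∀ {i j l} (l∈ : l ∈ˡ leaders ρ) {k} → element (blockSet ρ l) k ≡ i → Glued i j →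
      ∃ λ k′ → element (blockSet ρ l) k′ ≡ j × SameBlock (τ l∈) k k′
    glued⁻ l∈ {k} ≡.refl (glued l′∈ {k₁} {k′} e e′ k₁~k′)
      with leaders-≡ ρ l∈ l′∈ (ρ-trans (element-∈-block k)
             (ρ-sym (≡.subst (SameBlock ρ _) e (element-∈-block k₁))))
    ... | ≡.refl with unique⇒irrelevant (unique-leaders ρ) l∈ l′∈ | element-injective (blockSet ρ _) e
    ...   | ≡.refl | ≡.refl = k′ , e′ , k₁~k′

    glued⇒ρ : ∀ {i j} → Glued i j → SameBlock ρ i j
    glued⇒ρ (glued l∈ {k} {k′} ≡.refl ≡.refl _) = ρ-trans (ρ-sym (element-∈-block k)) (element-∈-block k′)

    glued? : ∀ i j → Dec (Glued i j)
    glued? i j with leader ρ i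
    ... | l , l∈ , l~i = map′
      (λ (k′ , e′ , k~k′) → glued l∈ (proj₂ (block-element l~i)) e′ k~k′)
      (glued⁻ l∈ (proj₂ (block-element l~i)))
      (any? λ k′ → (element (blockSet ρ l) k′ ≟ j) ×-dec sameBlock? (τ l∈) _ k′)

    glued-isEquivalence : IsEquivalence Glued
    glued-isEquivalence = record
      { refl  = λ {i} → let l , l∈ , l~i = leader ρ i ; k , e = block-element l~i in
          glued l∈ e e (IsEquivalence.refl (sameBlock-isEquivalence (τ l∈)))
      ; sym   = λ { (glued l∈ e e′ k~k′) →
          glued l∈ e′ e (IsEquivalence.sym (sameBlock-isEquivalence (τ l∈)) k~k′) }
      ; trans = λ { (glued l∈ e e′ k~k′) j~m → let k″ , e″ , k′~k″ = glued⁻ l∈ e′ j~m in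
          glued l∈ e e″ (IsEquivalence.trans (sameBlock-isEquivalence (τ l∈)) k~k′ k′~k″) }
      }

    -- Glued pairs are related by ρ. Since ρ is non-crossing, all four points lie in one block of ρ,
    -- where the partition chosen by τ is itself non-crossing.
    glued-nonCrossing : NonCrossing Glued
    glued-nonCrossing a<b b<c c<d a~c@(glued {l} l∈ {k} ≡.refl ≡.refl k~k″) b~d
      with block-element (ρ-trans (element-∈-block k)
             (sameBlock-nonCrossing ρ a<b b<c c<d (glued⇒ρ a~c) (glued⇒ρ b~d)))
    ... | k′ , ≡.refl with glued⁻ l∈ ≡.refl b~d
    ...   | k‴ , ≡.refl , k′~k‴ = glued l∈ ≡.refl ≡.refl
      (sameBlock-nonCrossing (τ l∈) (element-cancel-< W a<b) (element-cancel-< W b<c)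
        (element-cancel-< W c<d) k~k″ k′~k‴)
      where
      W : Subset n
      W = blockSet ρ l

    glue : NC n
    glue = fromRelation glued? glued-isEquivalence glued-nonCrossing

    glue-≼ : glue ≼ ρ
    glue-≼ = Equivalence.from ≼⇔ (λ i j → glued⇒ρ ∘ Equivalence.to (entry⇔ glued?))

    restrict-glue : ∀ {l} (l∈ : l ∈ˡ leaders ρ) → restrict glue (blockSet ρ l) ≡ τ l∈
    restrict-glue {l} l∈ = NC-≡ (λ k k′ → mk⇔
      (λ k~k′ →
        let k″ , e , k~k″ = glued⁻ l∈ ≡.refl
                              (Equivalence.to (entry⇔ glued?)
                                (Equivalence.to (sameBlock-restrict glue (blockSet ρ l)) k~k′))
        in ≡.subst (SameBlock (τ l∈) k) (element-injective (blockSet ρ l) e) k~k″)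
      (λ k~k′ → Equivalence.from (sameBlock-restrict glue (blockSet ρ l))
        (Equivalence.from (entry⇔ glued?) (glued l∈ ≡.refl ≡.refl k~k′))))

  -- The bijection between [0, ρ] and the product of the NC(|W|). Restriction is injective below ρ,
  -- and each tuple is attained because gluing it and restricting again gives it back.
  lowerInterval-↭ :
    List.map restrictions (filter (_≼? ρ) (allNC n)) ↭
    choices (λ l → allNC (size (block ρ l))) (leaders ρ)
  lowerInterval-↭ = unique-↭
    (unique-map restrictions (Unique.filter⁺ (_≼? ρ) (unique-allNC n))
      (λ π∈ σ∈ → restrictions-injective (below π∈) (below σ∈)))
    (unique-choices (λ l → unique-allNC (size (block ρ l))) (leaders ρ))
    (λ _ → ∈-choices ∈-allNC _)
    (λ {τs} _ → let open Glue (All.lookup τs) in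
      ≡.subst (_∈ˡ List.map restrictions (filter (_≼? ρ) (allNC n)))
        (choice-≡ λ l∈ → ≡.trans (lookup-universal _ l∈) (restrict-glue l∈))
        (∈-map⁺ restrictions (∈-filter⁺ (_≼? ρ) (∈-allNC glue) glue-≼)))
    where
    below : ∀ {π} → π ∈ˡ filter (_≼? ρ) (allNC n) → π ≼ ρ
    below π∈ = proj₂ (∈-filter⁻ (_≼? ρ) {xs = allNC n} π∈)

leaders-𝟙 : ∀ n → leaders (𝟙 (suc n)) ↭ zero ∷ []
leaders-𝟙 n = unique-↭ (unique-leaders (𝟙 (suc n))) ([] ∷ [])
  (λ {i} i∈ → here (leaders-≡ (𝟙 (suc n)) i∈ zero∈ (together i zero)))
  (λ { (here ≡.refl) → zero∈ })
  where
  together : ∀ i j → SameBlock (𝟙 (suc n)) i j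
  together i j rewrite lookup-replicate i (Vec.replicate (suc n) true) | lookup-replicate j true = _
  zero∈ : zero ∈ˡ leaders (𝟙 (suc n))
  zero∈ = ∈-filter⁺ (least? (𝟙 (suc n))) (∈-allFin zero) (λ _ ())

-- Evaluation of functionals on partitions and the action laws

module _ {c ℓ m ℓm} (K : CommutativeRing c ℓ) (A : Module K m ℓm) where

  open CommutativeRing K hiding (zero)
  open Convolution K
  open Functionals K A
  open SumsAndProducts K
  open Module A using (Carrierᴹ; ≈ᴹ-reflexive)
  open SetoidReasoning setoid

  -- Transports between arities that are equal but not by computation. Once the equality is matched,
  -- irrelevance of the `NonZero` instances makes the two functionals the same.
  ⟦⟧-cast : ∀ (ψ : 𝔐) {k l} .{{k≢0 : NonZero k}} .{{l≢0 : NonZero l}} (eq : k ≡ l)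
    {x : Vector Carrierᴹ k} {y : Vector Carrierᴹ l} →
    (∀ i → x i ≡ y (cast eq i)) → ⟦ ψ k ⟧ x ≈ ⟦ ψ l ⟧ y
  ⟦⟧-cast ψ {k} {{k≢0}} ≡.refl {y = y} x≡y =
    cong (ψ k {{k≢0}}) (λ i → ≈ᴹ-reflexive (≡.trans (x≡y i) (≡.cong y (cast-is-id ≡.refl i))))

  ⟦⟧-embed : ∀ (ψ : 𝔐) (x : Vector Carrierᴹ n) {U W V} .{{_ : NonZero ∣ U ∣}} .{{_ : NonZero ∣ V ∣}} →
    U ≡ embed W V → ⟦ ψ ∣ U ∣ ⟧ (x ∣ U) ≈ ⟦ ψ ∣ V ∣ ⟧ ((x ∣ W) ∣ V)
  ⟦⟧-embed ψ x {W = W} {V} ≡.refl =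
    ⟦⟧-cast ψ (∣embed∣ W V) (λ k → ≡.cong x (element-embed W V (∣embed∣ W V) k))

  -- The factors of ψ_π are grouped by the block of ρ that contains the given block of π; the
  -- factors in one group are those of the restriction of π to that block of ρ.
  evaluate-restrict : ∀ (ψ : 𝔐) {π ρ : NC n} → π ≼ ρ → ∀ x →
    evaluate ψ π x ≈ ∏[ l ← leaders ρ ] evaluate ψ (restrict π (blockSet ρ l)) (x ∣ blockSet ρ l)
  evaluate-restrict {n} ψ {π} {ρ} π≼ρ x = begin
    evaluate ψ π x
      ≡⟨ ∏-map (block π) (leaders π) _ ⟩
    ∏ (leaders π) factor
      ≈⟨ Prod.⨀-↭ (leaders-restrict ρ π≼ρ) factor ⟩
    ∏ (concatMap (λ l → List.map (element (blockSet ρ l)) (leaders (π↾ l))) (leaders ρ)) factor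
      ≈⟨ Prod.⨀-concatMap _ (leaders ρ) factor ⟩
    ∏[ l ← leaders ρ ] ∏ (List.map (element (blockSet ρ l)) (leaders (π↾ l))) factor
      ≈⟨ ∏-cong (leaders ρ) block-factor ⟩
    ∏[ l ← leaders ρ ] evaluate ψ (π↾ l) (x ∣ blockSet ρ l) ∎
    where
    π↾ : ∀ l → NC ∣ blockSet ρ l ∣
    π↾ l = restrict π (blockSet ρ l)

    factor : Fin n → Carrier
    factor i = ⟦ component ψ (block π i) ⟧ (x ∣ blockSet π i)

    block-factor : ∀ l → ∏ (List.map (element (blockSet ρ l)) (leaders (π↾ l))) factor ≈
      evaluate ψ (π↾ l) (x ∣ blockSet ρ l)
    block-factor l = begin
      ∏ (List.map (element (blockSet ρ l)) (leaders (π↾ l))) factor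
        ≡⟨ ∏-map (element (blockSet ρ l)) (leaders (π↾ l)) factor ⟩
      ∏[ k ← leaders (π↾ l) ] factor (element (blockSet ρ l) k)
        ≈⟨ ∏-cong (leaders (π↾ l)) (λ k →
             ⟦⟧-embed ψ x {{size-nonZero (block π (element (blockSet ρ l) k))}}
               {{size-nonZero (block (π↾ l) k)}}
               (blockSet-element π (blockSet-closed ρ π≼ρ l) k)) ⟩
      ∏[ k ← leaders (π↾ l) ] ⟦ component ψ (block (π↾ l) k) ⟧ ((x ∣ blockSet ρ l) ∣ blockSet (π↾ l) k)
        ≡⟨ ∏-map (block (π↾ l)) (leaders (π↾ l)) _ ⟨
      evaluate ψ (π↾ l) (x ∣ blockSet ρ l) ∎

  evaluate-· : ∀ (ψ : 𝔐) (g : 𝒢) .{{_ : NonZero n}} (ρ : NC n) x →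
    evaluate (ψ · fun g) ρ x ≈
    ∑[ π ← allNC n ] when (π ≼? ρ) (λ π≼ρ → fun g (mkNC² π ρ π≼ρ) * evaluate ψ π x)
  evaluate-· {n} ψ g ρ x = begin
    evaluate (ψ · fun g) ρ x
      ≡⟨ ∏-map (block ρ) (leaders ρ) _ ⟩
    ∏[ l ← leaders ρ ] ∑ (allNC ∣ blockSet ρ l ∣) (F l)
      ≈⟨ ∏-∑ F (λ l → allNC ∣ blockSet ρ l ∣) (leaders ρ) ⟩
    ∑ (choices (λ l → allNC ∣ blockSet ρ l ∣) (leaders ρ)) (choiceProduct F)
      ≈⟨ Sum.⨀-↭ (lowerInterval-↭ ρ) (choiceProduct F) ⟨
    ∑ (List.map (restrictions ρ) (filter (_≼? ρ) (allNC n))) (choiceProduct F)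
      ≈⟨ Sum.⨀-map (restrictions ρ) (filter (_≼? ρ) (allNC n)) (choiceProduct F) ⟩
    ∑[ π ← filter (_≼? ρ) (allNC n) ] choiceProduct F (restrictions ρ π)
      ≈⟨ ∑-filter (_≼? ρ) (allNC n) _ ⟩
    ∑[ π ← allNC n ] when (π ≼? ρ) (λ _ → choiceProduct F (restrictions ρ π))
      ≈⟨ ∑-cong (allNC n) (λ π → when-cong (π ≼? ρ) (π ≼? ρ) (λ p → p) (λ p → p)
           (λ π≼ρ _ → term π π≼ρ)) ⟩
    ∑[ π ← allNC n ] when (π ≼? ρ) (λ π≼ρ → fun g (mkNC² π ρ π≼ρ) * evaluate ψ π x) ∎
    where
    -- Blocks are nonempty, so their sizes are admissible arities for the pairs appearing in `G`.
    instance
      block-nonZero : ∀ {l} → NonZero ∣ blockSet ρ l ∣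
      block-nonZero {l} = size-nonZero (block ρ l)

    G : ∀ l → BlockPartition ρ l → Carrier
    G l τ = fun g (mkNC² τ (𝟙 _) ≼-𝟙)

    F : ∀ l → BlockPartition ρ l → Carrier
    F l τ = G l τ * evaluate ψ τ (x ∣ blockSet ρ l)

    π↾ : NC n → ∀ l → BlockPartition ρ l
    π↾ π l = restrict π (blockSet ρ l)

    term : ∀ π (π≼ρ : π ≼ ρ) →
      choiceProduct F (restrictions ρ π) ≈ fun g (mkNC² π ρ π≼ρ) * evaluate ψ π x
    term π π≼ρ = begin
      choiceProduct F (restrictions ρ π)
        ≡⟨ choiceProduct-universal F (π↾ π) (leaders ρ) ⟩
      ∏[ l ← leaders ρ ] F l (π↾ π l)
        ≈⟨ Prod.⨀-∙ (leaders ρ) _ _ ⟩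
      (∏[ l ← leaders ρ ] G l (π↾ π l)) * (∏[ l ← leaders ρ ] evaluate ψ (π↾ π l) (x ∣ blockSet ρ l))
        -- Multiplicativity of g gathers the values of `G` into g(π, ρ), and `evaluate-restrict`
        -- gathers the remaining factors into ψ_π.
        ≈⟨ *-cong
             (sym (trans (multiplicative g π ρ π≼ρ) (reflexive (∏-map (block ρ) (leaders ρ) _))))
             (sym (evaluate-restrict ψ π≼ρ x)) ⟩
      fun g (mkNC² π ρ π≼ρ) * evaluate ψ π x ∎

  -- The only block is the full set, enumerated by the identity up to `cast`.
  evaluate-𝟙 : ∀ (ψ : 𝔐) n .{{_ : NonZero n}} x → evaluate ψ (𝟙 n) x ≈ ⟦ ψ n ⟧ x
  evaluate-𝟙 ψ (suc n) x = begin
    evaluate ψ (𝟙 (suc n)) x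
      ≡⟨ ∏-map (block (𝟙 (suc n))) (leaders (𝟙 (suc n))) _ ⟩
    ∏[ i ← leaders (𝟙 (suc n)) ] ⟦ component ψ (block (𝟙 (suc n)) i) ⟧ (x ∣ blockSet (𝟙 (suc n)) i)
      ≈⟨ Prod.⨀-↭ (leaders-𝟙 n) _ ⟩
    -- The row of `zero` in the all-true matrix computes to `⊤`.
    ⟦ component ψ (block (𝟙 (suc n)) zero) ⟧ (x ∣ ⊤) * 1#
      ≈⟨ *-identityʳ _ ⟩
    ⟦ component ψ (block (𝟙 (suc n)) zero) ⟧ (x ∣ ⊤)
      ≈⟨ ⟦⟧-cast ψ {{size-nonZero (block (𝟙 (suc n)) zero)}} (∣⊤∣≡n (suc n))
           (λ k → ≡.cong x (element-⊤ (suc n) (∣⊤∣≡n (suc n)) k)) ⟩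
    ⟦ ψ (suc n) ⟧ x ∎

  -- The unit law of the action: δ(π, 1_n) vanishes unless π = 1_n, so a single term of the sum
  -- survives.
  ·-identity : ∀ (ψ : 𝔐) → ψ · δ ≈𝔐 ψ
  ·-identity ψ n x = begin
    ∑[ π ← allNC n ] when (π ≟ᴺ 𝟙 n) (λ _ → 1#) * evaluate ψ π x
      ≈⟨ ∑-cong (allNC n) (λ π → trans (when-*ʳ _ (π ≟ᴺ 𝟙 n))
           (when-cong (π ≟ᴺ 𝟙 n) (π ≟ᴺ 𝟙 n) (λ p → p) (λ p → p) (λ _ _ → *-identityˡ _))) ⟩
    ∑[ π ← allNC n ] when (π ≟ᴺ 𝟙 n) (λ _ → evaluate ψ π x)
      ≈⟨ ∑-filter (_≟ᴺ 𝟙 n) (allNC n) _ ⟨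
    ∑[ π ← filter (_≟ᴺ 𝟙 n) (allNC n) ] evaluate ψ π x
      ≈⟨ Sum.⨀-↭ (unique-↭ (Unique.filter⁺ (_≟ᴺ 𝟙 n) (unique-allNC n)) ([] ∷ [])
           (λ π∈ → here (proj₂ (∈-filter⁻ (_≟ᴺ 𝟙 n) {xs = allNC n} π∈)))
           (λ { (here ≡.refl) → ∈-filter⁺ (_≟ᴺ 𝟙 n) (∈-allNC (𝟙 n)) ≡.refl })) _ ⟩
    evaluate ψ (𝟙 n) x + 0#
      ≈⟨ +-identityʳ _ ⟩
    evaluate ψ (𝟙 n) x
      ≈⟨ evaluate-𝟙 ψ n x ⟩
    ⟦ ψ n ⟧ x ∎

  -- After `evaluate-·` the left side is a sum over pairs π ≤ ρ with ρ outermost. Exchanging the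
  -- sums puts π outermost, and the coefficient of ψ_π is then the convolution at (π, 1_n).
  ·-✶ : ∀ (ψ : 𝔐) (g₁ g₂ : 𝒢) → (ψ · fun g₁) · fun g₂ ≈𝔐 ψ · (fun g₁ ✶ fun g₂)
  ·-✶ ψ g₁ g₂ n x = begin
    ∑[ ρ ← allNC n ] fun g₂ (mkNC² ρ (𝟙 n) ≼-𝟙) * evaluate (ψ · fun g₁) ρ x
      ≈⟨ ∑-cong (allNC n) (λ ρ → trans (*-congˡ (evaluate-· ψ g₁ ρ x)) (∑-*ˡ _ (allNC n) _)) ⟩
    ∑[ ρ ← allNC n ] ∑[ π ← allNC n ] fun g₂ (mkNC² ρ (𝟙 n) ≼-𝟙) *
      when (π ≼? ρ) (λ π≼ρ → fun g₁ (mkNC² π ρ π≼ρ) * evaluate ψ π x)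
      ≈⟨ ∑-cong (allNC n) (λ ρ → ∑-cong (allNC n) (λ π → term π ρ)) ⟩
    ∑[ ρ ← allNC n ] ∑[ π ← allNC n ] summand π ρ * evaluate ψ π x
      ≈⟨ Sum.⨀-swap (allNC n) (allNC n) (λ ρ π → summand π ρ * evaluate ψ π x) ⟩
    ∑[ π ← allNC n ] ∑[ ρ ← allNC n ] summand π ρ * evaluate ψ π x
      ≈⟨ ∑-cong (allNC n) (λ π → ∑-*ʳ (evaluate ψ π x) (allNC n) (summand π)) ⟨
    ∑[ π ← allNC n ] (fun g₁ ✶ fun g₂) (mkNC² π (𝟙 n) ≼-𝟙) * evaluate ψ π x ∎
    where
    summand : NC n → NC n → Carrier
    summand π ρ = when (π ≼? ρ ×-dec ρ ≼? 𝟙 n) λ between →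
      fun g₁ (mkNC² π ρ (proj₁ between)) * fun g₂ (mkNC² ρ (𝟙 n) (proj₂ between))

    term : ∀ π ρ →
      fun g₂ (mkNC² ρ (𝟙 n) ≼-𝟙) * when (π ≼? ρ) (λ π≼ρ → fun g₁ (mkNC² π ρ π≼ρ) * evaluate ψ π x) ≈
      summand π ρ * evaluate ψ π x
    term π ρ = begin
      fun g₂ (mkNC² ρ (𝟙 n) ≼-𝟙) * when (π ≼? ρ) (λ π≼ρ → fun g₁ (mkNC² π ρ π≼ρ) * evaluate ψ π x)
        ≈⟨ when-*ˡ _ (π ≼? ρ) ⟩
      when (π ≼? ρ) (λ π≼ρ →
        fun g₂ (mkNC² ρ (𝟙 n) ≼-𝟙) * (fun g₁ (mkNC² π ρ π≼ρ) * evaluate ψ π x))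
        -- The convolution ranges over π ≤ ρ ≤ 1_n; as every ρ satisfies the second inequality, this
        -- is the same condition as π ≤ ρ.
        ≈⟨ when-cong (π ≼? ρ) (π ≼? ρ ×-dec ρ ≼? 𝟙 n) (_, ≼-𝟙) proj₁
             (λ _ _ → trans (sym (*-assoc _ _ _)) (*-congʳ (*-comm _ _))) ⟩
      when (π ≼? ρ ×-dec ρ ≼? 𝟙 n) (λ between →
        fun g₁ (mkNC² π ρ (proj₁ between)) * fun g₂ (mkNC² ρ (𝟙 n) (proj₂ between)) * evaluate ψ π x)
        ≈⟨ when-*ʳ _ (π ≼? ρ ×-dec ρ ≼? 𝟙 n) ⟨
      summand π ρ * evaluate ψ π x ∎

proposition6p5 :
  ∀ {m ℓm : Level} (A : Module ℂ-commutativeRing m ℓm) →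
  let open Convolution ℂ-commutativeRing
      open Functionals ℂ-commutativeRing A
  in (∀ (ψ : 𝔐) → ψ · δ ≈𝔐 ψ) ×
     (∀ (ψ : 𝔐) (g₁ g₂ : 𝒢) → (ψ · fun g₁) · fun g₂ ≈𝔐 ψ · (fun g₁ ✶ fun g₂))
proposition6p5 A = ·-identity ℂ-commutativeRing A , ·-✶ ℂ-commutativeRing A
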